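{- For $k\ge1$, $\ell\ge 0$ and $\lambda\in\mathrm{Par}^k_\ell$, we have $G_{1^\ell}^\perp\,\mathfrak g^{(k+1)}_{\lambda+1^\ell}=\mathfrak g^{(k)}_\lambda$, where $G_{1^\ell}=\sum_{i\ge0}(-1)^i\binom{\ell-1+i}{\ell-1}e_{\ell+i}$. Consequently also $G_{1^\ell}^\perp\,g^{(k+1)}_{\lambda+1^\ell}=g^{(k)}_\lambda$.
   Context: Let $\Lambda=\mathbb Z[h_1,h_2,\dots]$ be the ring of symmetric functions, with $h_d$, $e_d$ the complete homogeneous and elementary symmetric functions, $h_0=1$, $h_d=0$ for $d<0$. For $f\in\Lambda$, $f^\perp$ is the adjoint of multiplication by $f$ for the Hall inner product (Schur functions orthonormal); for a formal sum $f=\sum_{i\ge0}c_ie_{m+i}$ set $f^\perp=\sum_i c_ie_{m+i}^\perp$ (finite on each element of $\Lambda$). For $m,r\in\mathbb Z$ set $k_m^{(r)}=\sum_{i=0}^m\binom{r+i-1}{i}h_{m-i}$ ($\binom n0=1$, $\binom ni=n(n-1)\cdots(n-i+1)/i!$). For $\gamma\in\mathbb Z^\ell$ let $g_\gamma=\det(k^{(i-1)}_{\gamma_i+j-i})_{1\le i,j\le\ell}$. Let $\Delta^+_\ell=\{(i,j):1\le i<j\le\ell\}$. For $\Psi,\mathcal L\subset\Delta^+_\ell$ and $\gamma\in\mathbb Z^\ell$, define $K(\Psi;\mathcal L;\gamma)=g\big(\prod_{(i,j)\in\Psi}(1-z_i/z_j)^{ -1}\prod_{(i,j)\in\mathcal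 L}(1-1/z_j)\mathbf z^\gamma\big)$, where the expression is expanded in $\mathbb Z[[z_1/z_2,\dots,z_{\ell-1}/z_\ell]][z_1^{\pm1},\dots,z_\ell^{\pm1}]$ and $g$ is the additive map $\mathbf z^\gamma\mapsto g_\gamma$. Let $\mathrm{Par}^k_\ell=\{\mu\in\mathbb Z^\ell:k\ge\mu_1\ge\dots\ge\mu_\ell\ge0\}$; for $\mu\in\mathrm{Par}^k_\ell$ and $m\ge1$ set $\Delta^m(\mu)=\{(i,j)\in\Delta^+_\ell:m-\mu_i+i<j\}$, and $\mathfrak g^{(k)}_\mu=K(\Delta^k(\mu);\Delta^{k+1}(\mu);\mu)$. Also $\lambda+1^\ell=(\lambda_1+1,\dots,\lambda_\ell+1)$. The $g^{(k)}_\lambda$ are the $K$-$k$-Schur functions of Lam–Schilling–Shimozono (the $K$-homology Schubert representatives for the affine Grassmannian of $SL_{k+1}$), which are known to equal $\mathfrak g^{(k)}_\lambda$ for $\lambda\in\mathrm{Par}^k$. -}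

module Defs where

open import Data.Bool using (Bool; true; false; if_then_else_)
open import Data.Nat as ℕ using (ℕ; zero; suc; _∸_; _⊔_; _≤ᵇ_; _≡ᵇ_)
open import Data.Nat.Combinatorics using (_C_)
open import Data.Integer as ℤ using (ℤ; +_; -[1+_]; 0ℤ; 1ℤ; -_; _+_; _*_; _-_; ∣_∣)
open import Data.Fin as Fin using (Fin; toℕ; punchIn)
open import Data.Vec as Vec using (Vec)
open import Data.List as List using (List; []; _∷_; _++_; map; concatMap; foldr; upTo; allFin; length; filterᵇ; cartesianProduct)
open import Data.List.Properties using (≡-dec)
open import Data.List.Relation.Unary.All using (All)
open import Data.List.Relation.Unary.Linked using (Linked)
open import Data.Product using (_×_; _,_; proj₁; proj₂)
open import Relation.Binary.PropositionalEquality using (_≡_)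
open import Relation.Nullary using (does)

-- The ring Λ = ℤ[h₁,h₂,…], represented by (unnormalised) finite lists of
-- terms  c · h_{a₁+1} ⋯ h_{aᵣ+1}.  A monomial is a list of naturals, the
-- entry a standing for the variable h_{a+1} (so only h₁,h₂,… occur).
-- Two representatives are identified by the setoid equality _≈_ below
-- (equal coefficient of every monomial, monomials compared as multisets).

Mon : Set
Mon = List ℕ

Λ : Set
Λ = List (ℤ × Mon)

0Λ : Λ
0Λ = []

1Λ : Λ
1Λ = (1ℤ , []) ∷ []

infixl 6 _+Λ_ _-Λ_
infixl 7 _*Λ_

_+Λ_ : Λ → Λ → Λ
p +Λ q = p ++ q

scale : ℤ → Λ → Λ
scale c = map (λ t → (c * proj₁ t , proj₂ t))

negΛ : Λ → Λ
negΛ = scale (- 1ℤ)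

_-Λ_ : Λ → Λ → Λ
p -Λ q = p ++ negΛ q

_*Λ_ : Λ → Λ → Λ
p *Λ q = concatMap (λ t → map (λ u → (proj₁ t * proj₁ u , proj₂ t ++ proj₂ u)) q) p

sumΛ : List Λ → Λ
sumΛ = foldr _+Λ_ 0Λ

sumℤ : List ℤ → ℤ
sumℤ = foldr _+_ 0ℤ

insert : ℕ → List ℕ → List ℕ
insert x [] = x ∷ []
insert x (y ∷ ys) = if x ≤ᵇ y then x ∷ y ∷ ys else y ∷ insert x ys

sortℕ : List ℕ → List ℕ
sortℕ = foldr insert []

coeff : Λ → Mon → ℤ
coeff p m = sumℤ (map (λ t → if does (≡-dec ℕ._≟_ (sortℕ (proj₂ t)) (sortℕ m)) then proj₁ t else 0ℤ) p)

infix 4 _≈_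
_≈_ : Λ → Λ → Set
p ≈ q = ∀ m → coeff p m ≡ coeff q m

h : ℕ → Λ
h zero = 1Λ
h (suc n) = (1ℤ , n ∷ []) ∷ []

hℤ : ℤ → Λ
hℤ (+ n) = h n
hℤ -[1+ _ ] = 0Λ

sign : ℕ → ℤ
sign zero = 1ℤ
sign (suc n) = - sign n

det : (n : ℕ) → (Fin n → Fin n → Λ) → Λ
det zero M = 1Λ
det (suc n) M =
  sumΛ (map (λ j → scale (sign (toℕ j)) (M Fin.zero j *Λ det n (λ a b → M (Fin.suc a) (punchIn j b))))
            (allFin (suc n)))

-- Schur function via Jacobi–Trudi: s_λ = det (h_{λ_i - i + j})
schur : List ℕ → Λ
schur la = det (length la) (λ a b → hℤ (+ List.lookup la a - + toℕ a + + toℕ b))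

-- elementary symmetric function e_d = det (h_{1 - i + j})_{d×d}  ( = s_{1^d} )
e : ℕ → Λ
e d = det d (λ a b → hℤ (1ℤ - + toℕ a + + toℕ b))

IsPartition : List ℕ → Set
IsPartition la = All (λ x → 1 ℕ.≤ x) la × Linked ℕ._≥_ la

δ : List ℕ → List ℕ → ℤ
δ la mu = if does (≡-dec ℕ._≟_ la mu) then 1ℤ else 0ℤ

-- B is the Hall inner product: a ℤ-bilinear form on Λ (compatible with ≈)
-- for which the Schur functions are orthonormal.  Such a form exists and is
-- unique (the s_λ form a ℤ-basis of Λ).
record IsHall (B : Λ → Λ → ℤ) : Set where
  field
    resp : ∀ {p p′ q q′} → p ≈ p′ → q ≈ q′ → B p q ≡ B p′ q′
    addˡ : ∀ p p′ q → B (p +Λ p′) q ≡ B p q + B p′ q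
    addʳ : ∀ p q q′ → B p (q +Λ q′) ≡ B p q + B p q′
    orth : ∀ la mu → IsPartition la → IsPartition mu → B (schur la) (schur mu) ≡ δ la mu

-- generalised binomial coefficient  binom n i = n(n-1)⋯(n-i+1)/i!,  n ∈ ℤ, i ∈ ℕ
binomℤ : ℤ → ℕ → ℤ
binomℤ (+ n) i = + (n C i)
binomℤ -[1+ m ] i = sign i * + ((m ℕ.+ i) C i)

kk : ℤ → ℤ → Λ
kk r (+ m) = sumΛ (map (λ i → scale (binomℤ (r + + i - 1ℤ) i) (h (m ∸ i))) (upTo (suc m)))
kk r -[1+ _ ] = 0Λ

-- exponent vectors γ ∈ ℤ^ℓ are represented 1-indexed as functions ℕ → ℤ
-- g_γ = det (k^{(i-1)}_{γ_i + j - i})_{1≤i,j≤ℓ}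
gγ : (ℓ : ℕ) → (ℕ → ℤ) → Λ
gγ ℓ γ = det ℓ (λ a b → kk (+ toℕ a) (γ (suc (toℕ a)) + + toℕ b - + toℕ a))

Δ⁺ : ℕ → List (ℕ × ℕ)
Δ⁺ ℓ = filterᵇ (λ p → proj₁ p ℕ.<ᵇ proj₂ p) (cartesianProduct (map suc (upTo ℓ)) (map suc (upTo ℓ)))

raise : (ℕ → ℤ) → ℕ → ℕ → ℕ → (ℕ → ℤ)
raise γ i j n m = γ m + (if m ≡ᵇ i then + n else 0ℤ) - (if m ≡ᵇ j then + n else 0ℤ)

lower : (ℕ → ℤ) → ℕ → (ℕ → ℤ)
lower γ j m = γ m - (if m ≡ᵇ j then 1ℤ else 0ℤ)

-- g applied to  Π_{L} (1 - 1/z_j) z^γ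
expL : (ℓ : ℕ) → List (ℕ × ℕ) → (ℕ → ℤ) → Λ
expL ℓ [] γ = gγ ℓ γ
expL ℓ (ij ∷ ps) γ = expL ℓ ps γ -Λ expL ℓ ps (lower γ (proj₂ ij))

-- g applied to  Π_{Ψ} (Σ_{n=0}^{N} (z_i/z_j)^n) Π_{L}(1 - 1/z_j) z^γ
expΨ : (ℓ N : ℕ) → List (ℕ × ℕ) → List (ℕ × ℕ) → (ℕ → ℤ) → Λ
expΨ ℓ N [] Ls γ = expL ℓ Ls γ
expΨ ℓ N (ij ∷ ps) Ls γ =
  sumΛ (map (λ n → expΨ ℓ N ps Ls (raise γ (proj₁ ij) (proj₂ ij) n)) (upTo (suc N)))

-- Truncation bound.  g_δ = 0 as soon as δ_m < m - ℓ for some m (row m vanishes);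
-- every term of the expansion has  Σ_m m δ_m = Σ_m m γ_m - Σ n_{ij}(j-i) - Σ_S j,
-- so a nonzero term has every n_{ij} ≤ Σ_m m γ_m - Σ_m m(m-ℓ) ≤ bound ℓ γ.
-- Hence the truncated sum equals the full (formal) one.
bound : ℕ → (ℕ → ℤ) → ℕ
bound ℓ γ = ∣ sumℤ (map (λ m → + m * γ m - + m * (+ m - + ℓ)) (map suc (upTo ℓ))) ∣

K : (ℓ : ℕ) → (Ψ L : ℕ → ℕ → Bool) → (ℕ → ℤ) → Λ
K ℓ Ψ L γ = expΨ ℓ (bound ℓ γ)
                  (filterᵇ (λ p → Ψ (proj₁ p) (proj₂ p)) (Δ⁺ ℓ))
                  (filterᵇ (λ p → L (proj₁ p) (proj₂ p)) (Δ⁺ ℓ))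
                  γ

-- 1-indexed access to a vector (0 outside 1..ℓ)
at : ∀ {ℓ} → Vec ℕ ℓ → ℕ → ℤ
at Vec.[] _ = 0ℤ
at (x Vec.∷ xs) zero = 0ℤ
at (x Vec.∷ xs) (suc zero) = + x
at (x Vec.∷ xs) (suc (suc m)) = at xs (suc m)

Par : ∀ {ℓ} → ℕ → Vec ℕ ℓ → Set
Par {ℓ} k mu = (∀ (i : Fin ℓ) → Vec.lookup mu i ℕ.≤ k)
             × (∀ (i j : Fin ℓ) → i Fin.≤ j → Vec.lookup mu j ℕ.≤ Vec.lookup mu i)

Δᵐ : ∀ {ℓ} → ℕ → Vec ℕ ℓ → ℕ → ℕ → Bool
Δᵐ m mu i j = does ((+ m - at mu i + + i) ℤ.<? + j)

𝔤 : ∀ {ℓ} → ℕ → Vec ℕ ℓ → Λ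
𝔤 {ℓ} k mu = K ℓ (Δᵐ k mu) (Δᵐ (suc k) mu) (at mu)

plus1 : ∀ {ℓ} → Vec ℕ ℓ → Vec ℕ ℓ
plus1 = Vec.map suc

wdeg : Λ → ℕ
wdeg = foldr (λ t r → foldr ℕ._+_ 0 (map suc (proj₂ t)) ⊔ r) 0

-- coefficient of e_{ℓ+i} in G_{1^ℓ}:  (-1)^i binom(ℓ-1+i, ℓ-1) = (-1)^i binom(ℓ-1+i, i)
Gcoef : ℕ → ℕ → ℤ
Gcoef ℓ i = sign i * binomℤ (+ ℓ - 1ℤ + + i) i

-- ⟨G_{1^ℓ}^⊥ X , x⟩_B = Σ_i c_i ⟨X , e_{ℓ+i} x⟩_B ; terms with ℓ+i > deg X vanish,
-- so the sum is taken over 0 ≤ i ≤ wdeg X.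
GperpPair : ℕ → (Λ → Λ → ℤ) → Λ → Λ → ℤ
GperpPair ℓ B X x = sumℤ (map (λ i → Gcoef ℓ i * B X (e (ℓ ℕ.+ i) *Λ x)) (upTo (suc (wdeg X))))

{-# OPTIONS --safe #-}

-- A product of ℓ factors h_m is killed by e_j^⊥ for j > ℓ, because e_1^⊥ h_m = h_{m-1} and e_j^⊥ h_m = 0
-- for j ≥ 2.  The rows of g_γ are linear in the h_m, so e_{ℓ+i}^⊥ g_γ = 0 for i > 0,
-- while e_ℓ^⊥ lowers every index by one: e_ℓ^⊥ g_γ = g_{γ-1^ℓ}.  Hence only the leading term of
-- G_{1^ℓ} contributes, and since the root ideals of λ+1^ℓ at level k+1 are those of λ at level k, the
-- identity holds term by term in the expansion of K; the two truncation bounds differ, but g_γ = 0 as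
-- soon as Σ_m m (γ_m - m + ℓ) < 0, so both give the full sum.
--
-- What remains is that this derivation-like e_j^⊥ is adjoint to multiplication by e_j for a form known
-- only through the orthonormality of the Jacobi–Trudi determinants.  These are iterated Bernstein
-- operators B_d = Σ_i (-1)^i h_{d+i} e_i^⊥ applied to 1, and the commutation rules
--   e_i^⊥ B_d = B_d e_i^⊥ + B_{d-1} e_{i-1}^⊥,   e_a B_d = B_d e_a + B_{d+1} e_{a-1},   B_d B_{d+1} = 0
-- give both Pieri rules as sums over subsets, which match term by term.
module Submission where

open import Algebra.Bundles using (CommutativeRing; RawRing)
import Algebra.Properties.Ring as RingProperties
import Algebra.Solver.Ring
open import Algebra.Solver.Ring.AlmostCommutativeRing using (fromCommutativeRing; _-Raw-AlmostCommutative⟶_)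
open import Data.Bool using (Bool; true; false; if_then_else_)
open import Data.Empty using (⊥; ⊥-elim)
open import Data.Fin as Fin using (Fin; toℕ; punchIn; inject₁)
import Data.Fin.Properties as Finₚ
open import Data.Integer as ℤ using (ℤ; +_; -[1+_]; 0ℤ; 1ℤ)
import Data.Integer.Properties as ℤₚ
open import Data.Integer.Solver using (module +-*-Solver)
open import Data.List as List using (List; []; _∷_; length)
open import Data.List.Properties using (≡-dec; ∷-injective)
open import Data.List.Relation.Unary.All as All using (All; []; _∷_)
open import Data.List.Relation.Unary.Linked as Linked using (Linked; [-])
open import Data.Maybe as Maybe using (Maybe; just; nothing)
open import Data.Nat as ℕ using (ℕ; zero; suc; _≤_)
import Data.Nat.Properties as ℕₚ
open import Data.Product using (Σ; _×_; _,_; proj₁; proj₂)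
open import Data.Sum using (_⊎_; inj₁; inj₂)
open import Data.Unit using (⊤; tt)
open import Data.Vec as Vec using (Vec; []; _∷_; lookup; insertAt; replicate)
import Data.Vec.Properties as Vecₚ
open import Function using (_∘_; id)
open import Level using (0ℓ)
open import Relation.Binary.PropositionalEquality as ≡ using (_≡_; _≢_; module ≡-Reasoning)
open import Relation.Nullary using (yes; no; does)
open import Relation.Nullary.Decidable using (dec-true; dec-false)
import Defs

-- The form is known only on Schur functions, so adjointness is proved there and then extended
-- bilinearly; this requires that the `S α` span Λ. The Pieri sums range over all subsets and
-- contain sequences that are not partitions, whose straightening might bring in signs. It does not:
-- a partition changed by at most one in each place, always in the same direction, is again a
-- partition, or has neighbours c, c+1, or ends in -1, and in the last two cases its Schur function
-- is zero. So raising μ on a subset T and lowering γ on T, being inverse to each other, match with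
-- no cancellation. Both operator families are determined by their value at 1 and their commutation
-- with multiplication by h_a. All their relations are therefore proved by induction over the
-- generators, away from the list representation of Λ.

up dn : ℤ → ℤ
up (+ n) = + suc n
up -[1+ zero ] = + 0
up -[1+ suc n ] = -[1+ n ]
dn (+ zero) = -[1+ zero ]
dn (+ suc n) = + n
dn -[1+ n ] = -[1+ suc n ]

up-dn : ∀ i → up (dn i) ≡ i
up-dn (+ zero) = ≡.refl
up-dn (+ suc n) = ≡.refl
up-dn -[1+ n ] = ≡.refl

dn-up : ∀ i → dn (up i) ≡ i
dn-up (+ n) = ≡.refl
dn-up -[1+ zero ] = ≡.refl
dn-up -[1+ suc n ] = ≡.refl

-- `up` and `dn` are defined on constructors so that `dn (+ suc n)` computes to `+ n`. This equation
-- and `dn≡pred` lead back to ordinary addition where the solver or the order on ℤ is needed.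
up≡suc : ∀ i → up i ≡ 1ℤ ℤ.+ i
up≡suc (+ n) = ≡.refl
up≡suc -[1+ zero ] = ≡.refl
up≡suc -[1+ suc n ] = ≡.refl

dn≡pred : ∀ i → dn i ≡ ℤ.-1ℤ ℤ.+ i
dn≡pred (+ zero) = ≡.refl
dn≡pred (+ suc n) = ≡.refl
dn≡pred -[1+ n ] = ≡.refl

+-dn : ∀ x z → x ℤ.+ dn z ≡ dn (x ℤ.+ z)
+-dn x z = ≡.trans (≡.cong (ℤ._+_ x) (dn≡pred z)) (≡.trans (solve3 x z) (≡.sym (dn≡pred (x ℤ.+ z))))
  where
  solve3 : ∀ x z → x ℤ.+ (ℤ.-1ℤ ℤ.+ z) ≡ ℤ.-1ℤ ℤ.+ (x ℤ.+ z)
  solve3 = S.solve 2 (λ x z → x S.:+ (S.con ℤ.-1ℤ S.:+ z) S.:= S.con ℤ.-1ℤ S.:+ (x S.:+ z)) ≡.refl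
    where module S = +-*-Solver

ℤ-rawRing : RawRing 0ℓ 0ℓ
ℤ-rawRing = CommutativeRing.rawRing ℤₚ.+-*-commutativeRing

≟⇒ : ∀ (a b : ℤ) → Maybe (a ≡ b)
≟⇒ a b with a ℤ.≟ b
... | yes eq = just eq
... | no _ = nothing

module RingSolver (R : CommutativeRing 0ℓ 0ℓ) (ι : ℤ-rawRing -Raw-AlmostCommutative⟶ fromCommutativeRing R) where
  open CommutativeRing R using (reflexive)
  open Algebra.Solver.Ring ℤ-rawRing (fromCommutativeRing R) ι
    (λ a b → Maybe.map (λ eq → reflexive (≡.cong (_-Raw-AlmostCommutative⟶_.⟦_⟧ ι) eq)) (≟⇒ a b)) public

-- Abstractly, Λ with its operators E i = e_i^⊥ and the Bernstein operators
-- B d = Σ_i (-1)^i h_{d+i} e_i^⊥, whose iterates on 1 are the Jacobi–Trudi determinants.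

record BernsteinAlgebra : Set₁ where
  field
    commRing : CommutativeRing 0ℓ 0ℓ
    const : ℤ-rawRing -Raw-AlmostCommutative⟶ fromCommutativeRing commRing
  open CommutativeRing commRing public
  field
    h : ℤ → Carrier
    h-zero : h 0ℤ ≈ 1#
    h-neg : ∀ n → h -[1+ n ] ≈ 0#
    E B : ℤ → Carrier → Carrier
    E-cong : ∀ i {X Y} → X ≈ Y → E i X ≈ E i Y
    E-+ : ∀ i X Y → E i (X + Y) ≈ E i X + E i Y
    E-1 : E 0ℤ 1# ≈ 1#
    E-1-suc : ∀ n → E (+ suc n) 1# ≈ 0#
    E-1-neg : ∀ n → E -[1+ n ] 1# ≈ 0#
    -- Coproduct rule for e_i^⊥ on a product: on h_a only e_0^⊥ and e_1^⊥ are nonzero.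
    E-h : ∀ i a X → E i (h a * X) ≈ h a * E i X + h (dn a) * E (dn i) X
    B-cong : ∀ d {X Y} → X ≈ Y → B d X ≈ B d Y
    B-+ : ∀ d X Y → B d (X + Y) ≈ B d X + B d Y
    B-1 : ∀ d → B d 1# ≈ h d
    -- Comes from inserting `E-h` into Σ_i (-1)^i h_{d+i} e_i^⊥; shifting i by one in the second sum
    -- gives the sign.
    B-h : ∀ d a X → B d (h a * X) ≈ h a * B d X - h (dn a) * B (up d) X
    ind : (Q : Carrier → Set) → (∀ {X Y} → X ≈ Y → Q X → Q Y) →
          (∀ {X Y} → Q X → Q Y → Q (X + Y)) → (∀ {X} → Q X → Q (- X)) →
          Q 1# → (∀ a {X} → Q X → Q (h a * X)) → ∀ X → Q X

-- Commutation relations of the operators `E` and `B`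

module Theory (A : BernsteinAlgebra) where
  open BernsteinAlgebra A
  open RingProperties ring using (-0#≈0#; +-cancelˡ; -‿distribʳ-*)
  open import Relation.Binary.Reasoning.Setoid setoid
  open RingSolver commRing const using (solve; _:=_; _:+_; _:*_; _:-_; :-_; con)

  record Additive (P : Carrier → Carrier) : Set where
    field
      P-cong : ∀ {X Y} → X ≈ Y → P X ≈ P Y
      P-+ : ∀ X Y → P (X + Y) ≈ P X + P Y

    P-0 : P 0# ≈ 0#
    P-0 = +-cancelˡ (P 0#) (P 0#) 0# (trans (sym (P-+ 0# 0#)) (trans (P-cong (+-identityʳ 0#)) (sym (+-identityʳ (P 0#)))))

    P-neg : ∀ X → P (- X) ≈ - P X
    P-neg X = +-cancelˡ (P X) (P (- X)) (- P X) (begin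
      P X + P (- X)  ≈⟨ P-+ X (- X) ⟨
      P (X - X)      ≈⟨ P-cong (-‿inverseʳ X) ⟩
      P 0#           ≈⟨ P-0 ⟩
      0#             ≈⟨ -‿inverseʳ (P X) ⟨
      P X - P X      ∎)

    P-- : ∀ X Y → P (X - Y) ≈ P X - P Y
    P-- X Y = trans (P-+ X (- Y)) (+-congˡ (P-neg Y))

  open Additive

  *-additive : ∀ Z → Additive (Z *_)
  *-additive Z = record { P-cong = *-congˡ ; P-+ = distribˡ Z }

  E-additive : ∀ i → Additive (E i)
  E-additive i = record { P-cong = E-cong i ; P-+ = E-+ i }

  B-additive : ∀ i → Additive (B i)
  B-additive i = record { P-cong = B-cong i ; P-+ = B-+ i }

  ∘-additive : ∀ {P Q} → Additive P → Additive Q → Additive (P ∘ Q)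
  ∘-additive p q = record
    { P-cong = λ eq → P-cong p (P-cong q eq)
    ; P-+ = λ X Y → trans (P-cong p (P-+ q X Y)) (P-+ p _ _) }

  +-additive : ∀ {P Q} → Additive P → Additive Q → Additive (λ X → P X + Q X)
  +-additive p q = record
    { P-cong = λ eq → +-cong (P-cong p eq) (P-cong q eq)
    ; P-+ = λ X Y → trans (+-cong (P-+ p X Y) (P-+ q X Y)) (solve 4 (λ a b c d → (a :+ b) :+ (c :+ d) := (a :+ c) :+ (b :+ d)) refl _ _ _ _) }

  0-additive : Additive (λ _ → 0#)
  0-additive = record { P-cong = λ _ → refl ; P-+ = λ _ _ → sym (+-identityʳ 0#) }

  id-additive : Additive (λ X → X)
  id-additive = record { P-cong = λ eq → eq ; P-+ = λ _ _ → refl }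

  -- The index j is quantified inside the induction, because moving `h a` through `E` or `B` shifts
  -- their indices and calls the hypothesis at the shifted ones.
  additive-ind : {J : Set} (P Q : J → Carrier → Carrier) → (∀ j → Additive (P j)) → (∀ j → Additive (Q j)) →
    (∀ j → P j 1# ≈ Q j 1#) →
    (∀ a X → (∀ j → P j X ≈ Q j X) → ∀ j → P j (h a * X) ≈ Q j (h a * X)) →
    ∀ j X → P j X ≈ Q j X
  additive-ind P Q p q one mul j X = ind (λ X → ∀ j → P j X ≈ Q j X)
    (λ eq hyp j → trans (P-cong (p j) (sym eq)) (trans (hyp j) (P-cong (q j) eq)))
    (λ hX hY j → trans (P-+ (p j) _ _) (trans (+-cong (hX j) (hY j)) (sym (P-+ (q j) _ _))))
    (λ hX j → trans (P-neg (p j) _) (trans (-‿cong (hX j)) (sym (P-neg (q j) _))))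
    one (λ a → mul a _) X j

  -‿cong₂ : ∀ {X X′ Y Y′} → X ≈ X′ → Y ≈ Y′ → X - Y ≈ X′ - Y′
  -‿cong₂ p q = +-cong p (-‿cong q)

  x-0≈x : ∀ X → X - 0# ≈ X
  x-0≈x X = trans (+-congˡ -0#≈0#) (+-identityʳ X)

  h≈h*1 : ∀ d → h d ≈ h d * 1#
  h≈h*1 d = sym (*-identityʳ (h d))

  B-E-1 : ∀ d i → B d (E i 1#) ≈ h d * E i 1#
  B-E-1 d (+ zero) = trans (B-cong d E-1) (trans (B-1 d) (trans (h≈h*1 d) (*-congˡ (sym E-1))))
  B-E-1 d (+ suc n) = trans (B-cong d (E-1-suc n)) (trans (P-0 (B-additive d)) (trans (sym (zeroʳ (h d))) (*-congˡ (sym (E-1-suc n)))))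
  B-E-1 d -[1+ n ] = trans (B-cong d (E-1-neg n)) (trans (P-0 (B-additive d)) (trans (sym (zeroʳ (h d))) (*-congˡ (sym (E-1-neg n)))))

  E-B : ∀ i d X → E i (B d X) ≈ B d (E i X) + B (dn d) (E (dn i) X)
  E-B i d = additive-ind {ℤ × ℤ} (λ (i , d) X → E i (B d X)) (λ (i , d) X → B d (E i X) + B (dn d) (E (dn i) X))
    (λ (i , d) → ∘-additive (E-additive i) (B-additive d))
    (λ (i , d) → +-additive (∘-additive (B-additive d) (E-additive i)) (∘-additive (B-additive (dn d)) (E-additive (dn i))))
    (λ (i , d) → begin
      E i (B d 1#)                                 ≈⟨ E-cong i (trans (B-1 d) (h≈h*1 d)) ⟩
      E i (h d * 1#)                               ≈⟨ E-h i d 1# ⟩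
      h d * E i 1# + h (dn d) * E (dn i) 1#        ≈⟨ +-cong (B-E-1 d i) (B-E-1 (dn d) (dn i)) ⟨
      B d (E i 1#) + B (dn d) (E (dn i) 1#)        ∎)
    step (i , d)
    where
    step : ∀ a X → (∀ ((i , d) : ℤ × ℤ) → E i (B d X) ≈ B d (E i X) + B (dn d) (E (dn i) X)) →
           ∀ ((i , d) : ℤ × ℤ) → E i (B d (h a * X)) ≈ B d (E i (h a * X)) + B (dn d) (E (dn i) (h a * X))
    step a X IH (i , d) = begin
      E i (B d (h a * X))
        ≈⟨ E-cong i (B-h d a X) ⟩
      E i (h a * B d X - h a′ * B d⁺ X)
        ≈⟨ P-- (E-additive i) _ _ ⟩
      E i (h a * B d X) - E i (h a′ * B d⁺ X)
        ≈⟨ -‿cong₂ (E-h i a _) (E-h i a′ _) ⟩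
      h a * E i (B d X) + h a′ * E i′ (B d X) - (h a′ * E i (B d⁺ X) + h a″ * E i′ (B d⁺ X))
        ≈⟨ -‿cong₂ (+-cong (*-congˡ (IH (i , d))) (*-congˡ (IH (i′ , d)))) (+-cong (*-congˡ (IH⁺ i)) (*-congˡ (IH⁺ i′))) ⟩
      h a * (B d (E i X) + B d′ (E i′ X)) + h a′ * (B d (E i′ X) + B d′ (E i″ X))
        - (h a′ * (B d⁺ (E i X) + B d (E i′ X)) + h a″ * (B d⁺ (E i′ X) + B d (E i″ X)))
        -- On either side the two terms `a′ :* z`, that is h_{a-1} B_d E_{i-1} X, cancel; the right
        -- side is grouped into four instances of `B-h`.
        ≈⟨ solve 10 (λ a a′ a″ x y z u v w t →
             a :* (x :+ y) :+ a′ :* (z :+ u) :- (a′ :* (v :+ z) :+ a″ :* (w :+ t)) :=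
             ((a :* x :- a′ :* v) :+ (a′ :* z :- a″ :* w)) :+ ((a :* y :- a′ :* z) :+ (a′ :* u :- a″ :* t)))
             refl (h a) (h a′) (h a″) (B d (E i X)) (B d′ (E i′ X)) (B d (E i′ X)) (B d′ (E i″ X)) (B d⁺ (E i X)) (B d⁺ (E i′ X)) (B d (E i″ X)) ⟩
      ((h a * B d (E i X) - h a′ * B d⁺ (E i X)) + (h a′ * B d (E i′ X) - h a″ * B d⁺ (E i′ X))) +
      ((h a * B d′ (E i′ X) - h a′ * B d (E i′ X)) + (h a′ * B d′ (E i″ X) - h a″ * B d (E i″ X)))
        ≈⟨ +-cong (+-cong (B-h d a _) (B-h d a′ _)) (+-cong (B-h′ a _) (B-h′ a′ _)) ⟨
      (B d (h a * E i X) + B d (h a′ * E i′ X)) + (B d′ (h a * E i′ X) + B d′ (h a′ * E i″ X))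
        ≈⟨ +-cong (P-+ (B-additive d) _ _) (P-+ (B-additive d′) _ _) ⟨
      B d (h a * E i X + h a′ * E i′ X) + B d′ (h a * E i′ X + h a′ * E i″ X)
        ≈⟨ +-cong (B-cong d (E-h i a X)) (B-cong d′ (E-h i′ a X)) ⟨
      B d (E i (h a * X)) + B d′ (E i′ (h a * X)) ∎
      where
      a′ = dn a
      a″ = dn a′
      d′ = dn d
      d⁺ = up d
      i′ = dn i
      i″ = dn i′
      IH⁺ : ∀ i → E i (B d⁺ X) ≈ B d⁺ (E i X) + B d (E (dn i) X)
      IH⁺ i = ≡.subst (λ c → E i (B d⁺ X) ≈ B d⁺ (E i X) + B c (E (dn i) X)) (dn-up d) (IH (i , d⁺))
      B-h′ : ∀ a Y → B d′ (h a * Y) ≈ h a * B d′ Y - h (dn a) * B d Y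
      B-h′ a Y = ≡.subst (λ c → B d′ (h a * Y) ≈ h a * B d′ Y - h (dn a) * B c Y) (up-dn d) (B-h d′ a Y)

  B-B-h : ∀ a b c X → B a (B b (h c * X)) ≈
    (h c * B a (B b X) - h (dn c) * (B (up a) (B b X) + B a (B (up b) X))) + h (dn (dn c)) * B (up a) (B (up b) X)
  B-B-h a b c X = begin
    B a (B b (h c * X))                                    ≈⟨ B-cong a (B-h b c X) ⟩
    B a (h c * B b X - h (dn c) * B (up b) X)              ≈⟨ P-- (B-additive a) _ _ ⟩
    B a (h c * B b X) - B a (h (dn c) * B (up b) X)        ≈⟨ -‿cong₂ (B-h a c _) (B-h a (dn c) _) ⟩
    (h c * B a (B b X) - h (dn c) * B (up a) (B b X)) - (h (dn c) * B a (B (up b) X) - h (dn (dn c)) * B (up a) (B (up b) X))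
      ≈⟨ solve 7 (λ c c′ c″ x y z w → (c :* x :- c′ :* y) :- (c′ :* z :- c″ :* w) := (c :* x :- c′ :* (y :+ z)) :+ c″ :* w) refl _ _ _ _ _ _ _ ⟩
    _ ∎

  B-h-1 : ∀ a b → B a (B b 1#) ≈ h b * h a - h (dn b) * h (up a)
  B-h-1 a b = begin
    B a (B b 1#)                                  ≈⟨ B-cong a (trans (B-1 b) (h≈h*1 b)) ⟩
    B a (h b * 1#)                                ≈⟨ B-h a b 1# ⟩
    h b * B a 1# - h (dn b) * B (up a) 1#         ≈⟨ -‿cong₂ (*-congˡ (B-1 a)) (*-congˡ (B-1 (up a))) ⟩
    h b * h a - h (dn b) * h (up a) ∎

  -- This is the interchange of two rows of a Jacobi-Trudi determinant. Multiplying by `h c` turns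
  -- the relation into a combination of its own instances at (a,b), (a+1,b), (a,b+1) and (a+1,b+1),
  -- so the induction closes.
  B-exchange : ∀ a b X → B a (B b X) + B (dn b) (B (up a) X) ≈ 0#
  B-exchange a b = additive-ind {ℤ × ℤ} (λ (a , b) X → B a (B b X) + B (dn b) (B (up a) X)) (λ _ _ → 0#)
    (λ (a , b) → +-additive (∘-additive (B-additive a) (B-additive b)) (∘-additive (B-additive (dn b)) (B-additive (up a))))
    (λ _ → 0-additive)
    (λ (a , b) → begin
      B a (B b 1#) + B (dn b) (B (up a) 1#)
        ≈⟨ +-cong (B-h-1 a b) (B-h-1 (dn b) (up a)) ⟩
      (h b * h a - h (dn b) * h (up a)) + (h (up a) * h (dn b) - h (dn (up a)) * h (up (dn b)))
        ≡⟨ ≡.cong₂ (λ a′ b′ → (h b * h a - h (dn b) * h (up a)) + (h (up a) * h (dn b) - h a′ * h b′)) (dn-up a) (up-dn b) ⟩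
      (h b * h a - h (dn b) * h (up a)) + (h (up a) * h (dn b) - h a * h b)
        ≈⟨ solve 4 (λ x y z w → (x :* y :- z :* w) :+ (w :* z :- y :* x) := con 0ℤ) refl (h b) (h a) (h (dn b)) (h (up a)) ⟩
      _ ≈⟨ const-0 ⟩
      0# ∎)
    step (a , b)
    where
    open _-Raw-AlmostCommutative⟶_ const using () renaming (0-homo to const-0)
    step : ∀ c X → (∀ ((a , b) : ℤ × ℤ) → B a (B b X) + B (dn b) (B (up a) X) ≈ 0#) →
           ∀ ((a , b) : ℤ × ℤ) → B a (B b (h c * X)) + B (dn b) (B (up a) (h c * X)) ≈ 0#
    step c X IH (a , b) = begin
      B a (B b (h c * X)) + B b′ (B a⁺ (h c * X))
        ≈⟨ +-cong (B-B-h a b c X) (B-B-h b′ a⁺ c X) ⟩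
      ((h c * B a (B b X) - h c′ * (B a⁺ (B b X) + B a (B b⁺ X))) + h c″ * B a⁺ (B b⁺ X)) +
      ((h c * B b′ (B a⁺ X) - h c′ * (B (up b′) (B a⁺ X) + B b′ (B a⁺⁺ X))) + h c″ * B (up b′) (B a⁺⁺ X))
        ≡⟨ ≡.cong (λ β → ((h c * B a (B b X) - h c′ * (B a⁺ (B b X) + B a (B b⁺ X))) + h c″ * B a⁺ (B b⁺ X)) +
             ((h c * B b′ (B a⁺ X) - h c′ * (B β (B a⁺ X) + B b′ (B a⁺⁺ X))) + h c″ * B β (B a⁺⁺ X))) (up-dn b) ⟩
      ((h c * B a (B b X) - h c′ * (B a⁺ (B b X) + B a (B b⁺ X))) + h c″ * B a⁺ (B b⁺ X)) +
      ((h c * B b′ (B a⁺ X) - h c′ * (B b (B a⁺ X) + B b′ (B a⁺⁺ X))) + h c″ * B b (B a⁺⁺ X))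
        ≈⟨ solve 11 (λ c c′ c″ x y z w x′ y′ z′ w′ →
             ((c :* x :- c′ :* (y :+ z)) :+ c″ :* w) :+ ((c :* x′ :- c′ :* (y′ :+ z′)) :+ c″ :* w′) :=
             (c :* (x :+ x′) :- c′ :* ((y :+ z′) :+ (z :+ y′))) :+ c″ :* (w :+ w′)) refl _ _ _ _ _ _ _ _ _ _ _ ⟩
      (h c * (B a (B b X) + B b′ (B a⁺ X)) - h c′ * ((B a⁺ (B b X) + B b′ (B a⁺⁺ X)) + (B a (B b⁺ X) + B b (B a⁺ X))))
        + h c″ * (B a⁺ (B b⁺ X) + B b (B a⁺⁺ X))
        ≈⟨ +-cong (-‿cong₂ (*-congˡ (IH (a , b))) (*-congˡ (+-cong (IH (a⁺ , b)) (IH⁺ a)))) (*-congˡ (IH⁺ a⁺)) ⟩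
      (h c * 0# - h c′ * (0# + 0#)) + h c″ * 0#
        ≈⟨ +-cong (-‿cong₂ (zeroʳ _) (trans (*-congˡ (+-identityʳ 0#)) (zeroʳ _))) (zeroʳ _) ⟩
      (0# - 0#) + 0# ≈⟨ trans (+-identityʳ _) (-‿inverseʳ 0#) ⟩
      0# ∎
      where
      c′ = dn c
      c″ = dn c′
      b′ = dn b
      b⁺ = up b
      a⁺ = up a
      a⁺⁺ = up a⁺
      IH⁺ : ∀ a → B a (B b⁺ X) + B b (B (up a) X) ≈ 0#
      IH⁺ a = ≡.subst (λ β → B a (B b⁺ X) + B β (B (up a) X) ≈ 0#) (dn-up b) (IH (a , b⁺))

  -- B-exchange only gives twice this identity.
  B-B-up : ∀ a X → B a (B (up a) X) ≈ 0#
  B-B-up = additive-ind (λ a X → B a (B (up a) X)) (λ _ _ → 0#)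
    (λ a → ∘-additive (B-additive a) (B-additive (up a))) (λ _ → 0-additive)
    (λ a → begin
      B a (B (up a) 1#)                              ≈⟨ B-h-1 a (up a) ⟩
      h (up a) * h a - h (dn (up a)) * h (up a)      ≡⟨ ≡.cong (λ b → h (up a) * h a - h b * h (up a)) (dn-up a) ⟩
      h (up a) * h a - h a * h (up a)                ≈⟨ +-congˡ (-‿cong (*-comm _ _)) ⟩
      h (up a) * h a - h (up a) * h a                ≈⟨ -‿inverseʳ _ ⟩
      0# ∎)
    (λ c X IH a → begin
      B a (B (up a) (h c * X))
        ≈⟨ B-B-h a (up a) c X ⟩
      (h c * B a (B (up a) X) - h (dn c) * (B (up a) (B (up a) X) + B a (B (up (up a)) X))) + h (dn (dn c)) * B (up a) (B (up (up a)) X)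
        -- The middle bracket is not an instance of the claim; it vanishes by `B-exchange` at (a+1,
        -- a+1).
        ≈⟨ +-cong (-‿cong₂ (*-congˡ (IH a)) (*-congˡ (≡.subst (λ b → B (up a) (B (up a) X) + B b (B (up (up a)) X) ≈ 0#) (dn-up a) (B-exchange (up a) (up a) X)))) (*-congˡ (IH (up a))) ⟩
      (h c * 0# - h (dn c) * 0#) + h (dn (dn c)) * 0#
        ≈⟨ +-cong (-‿cong₂ (zeroʳ _) (zeroʳ _)) (zeroʳ _) ⟩
      (0# - 0#) + 0# ≈⟨ trans (+-identityʳ _) (-‿inverseʳ 0#) ⟩
      0# ∎)

  E-neg : ∀ n X → E -[1+ n ] X ≈ 0#
  E-neg = additive-ind (λ n → E -[1+ n ]) (λ _ _ → 0#) (λ n → E-additive -[1+ n ]) (λ _ → 0-additive) E-1-neg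
    (λ a X IH n → trans (E-h -[1+ n ] a X) (trans (+-cong (trans (*-congˡ (IH n)) (zeroʳ _)) (trans (*-congˡ (IH (suc n))) (zeroʳ _))) (+-identityʳ 0#)))

  E-zero : ∀ X → E 0ℤ X ≈ X
  E-zero X = additive-ind {ℕ} (λ _ → E 0ℤ) (λ _ X → X) (λ _ → E-additive 0ℤ) (λ _ → id-additive) (λ _ → E-1)
    (λ a X IH n → trans (E-h 0ℤ a X) (trans (+-cong (*-congˡ (IH n)) (trans (*-congˡ (E-neg 0 X)) (zeroʳ _))) (+-identityʳ _))) 0 X

  -- f 0 - f 1 + f 2 - ..., nested so that splitting off the head needs no sign factor.
  alt : ∀ n → (Fin n → Carrier) → Carrier
  alt zero f = 0#
  alt (suc n) f = f Fin.zero - alt n (f ∘ Fin.suc)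

  alt-cong : ∀ n {f g : Fin n → Carrier} → (∀ k → f k ≈ g k) → alt n f ≈ alt n g
  alt-cong zero eq = refl
  alt-cong (suc n) eq = -‿cong₂ (eq Fin.zero) (alt-cong n (eq ∘ Fin.suc))

  alt-0 : ∀ n {f : Fin n → Carrier} → (∀ k → f k ≈ 0#) → alt n f ≈ 0#
  alt-0 zero eq = refl
  alt-0 (suc n) eq = trans (-‿cong₂ (eq Fin.zero) (alt-0 n (eq ∘ Fin.suc))) (-‿inverseʳ 0#)

  alt-additive : ∀ {P} → Additive P → ∀ n f → P (alt n f) ≈ alt n (P ∘ f)
  alt-additive p zero f = P-0 p
  alt-additive p (suc n) f = trans (P-- p _ _) (-‿cong₂ refl (alt-additive p n (f ∘ Fin.suc)))

  alt-+ : ∀ n f g → alt n (λ k → f k + g k) ≈ alt n f + alt n g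
  alt-+ zero f g = sym (+-identityʳ 0#)
  alt-+ (suc n) f g = trans (-‿cong₂ refl (alt-+ n _ _)) (solve 4 (λ a b c d → (a :+ b) :- (c :+ d) := (a :- c) :+ (b :- d)) refl _ _ _ _)

  -- The increment hits the argument first, so that `bernSum (suc N) d φ` unfolds definitionally to
  -- `h d * φ 0 - bernSum N (up d) (φ ∘ suc)`.
  upBy : ℕ → ℤ → ℤ
  upBy zero d = d
  upBy (suc n) d = upBy n (up d)

  bernSum : ℕ → ℤ → (ℕ → Carrier) → Carrier
  bernSum N d φ = alt N (λ k → h (upBy (toℕ k) d) * φ (toℕ k))

  bernSum-cong : ∀ N d {φ ψ : ℕ → Carrier} → (∀ j → φ j ≈ ψ j) → bernSum N d φ ≈ bernSum N d ψ
  bernSum-cong N d eq = alt-cong N (λ k → *-congˡ (eq (toℕ k)))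

  bernSum-truncate : ∀ n N d φ → (∀ j → φ (n ℕ.+ j) ≈ 0#) → bernSum (n ℕ.+ N) d φ ≈ bernSum n d φ
  bernSum-truncate zero N d φ eq = alt-0 N (λ k → trans (*-congˡ (eq (toℕ k))) (zeroʳ _))
  bernSum-truncate (suc n) N d φ eq = -‿cong₂ refl (bernSum-truncate n N (up d) (φ ∘ suc) eq)

  -- Recovers the formula Σ_j (-1)^j h_{d+j} e_j^⊥ from the commutation rules. It speaks of all
  -- truncations from some N on, so that the bounds of two summands can be enlarged to a common one.
  B-as-sum : ∀ X → Σ ℕ λ N → ∀ M d → bernSum (N ℕ.+ M) d (λ j → E (+ j) X) ≈ B d X
  B-as-sum = ind (λ X → Σ ℕ λ N → ∀ M d → bernSum (N ℕ.+ M) d (λ j → E (+ j) X) ≈ B d X)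
    (λ eq (N , hyp) → N , λ M d → trans (bernSum-cong (N ℕ.+ M) d (λ j → E-cong (+ j) (sym eq))) (trans (hyp M d) (B-cong d eq)))
    (λ {X} {Y} (N , hX) (N′ , hY) → N ℕ.+ N′ , λ M d → begin
      bernSum (N ℕ.+ N′ ℕ.+ M) d (λ j → E (+ j) (X + Y))
        ≈⟨ alt-cong (N ℕ.+ N′ ℕ.+ M) (λ k → trans (*-congˡ (E-+ (+ toℕ k) X Y)) (distribˡ _ _ _)) ⟩
      alt (N ℕ.+ N′ ℕ.+ M) (λ k → h (upBy (toℕ k) d) * E (+ toℕ k) X + h (upBy (toℕ k) d) * E (+ toℕ k) Y)
        ≈⟨ alt-+ (N ℕ.+ N′ ℕ.+ M) _ _ ⟩
      bernSum (N ℕ.+ N′ ℕ.+ M) d (λ j → E (+ j) X) + bernSum (N ℕ.+ N′ ℕ.+ M) d (λ j → E (+ j) Y)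
        ≡⟨ ≡.cong₂ (λ n n′ → bernSum n d (λ j → E (+ j) X) + bernSum n′ d (λ j → E (+ j) Y)) (ℕₚ.+-assoc N N′ M)
             (≡.trans (≡.cong (ℕ._+ M) (ℕₚ.+-comm N N′)) (ℕₚ.+-assoc N′ N M)) ⟩
      bernSum (N ℕ.+ (N′ ℕ.+ M)) d (λ j → E (+ j) X) + bernSum (N′ ℕ.+ (N ℕ.+ M)) d (λ j → E (+ j) Y)
        ≈⟨ +-cong (hX (N′ ℕ.+ M) d) (hY (N ℕ.+ M) d) ⟩
      B d X + B d Y ≈⟨ B-+ d X Y ⟨
      B d (X + Y) ∎)
    (λ {X} (N , hyp) → N , λ M d → begin
      bernSum (N ℕ.+ M) d (λ j → E (+ j) (- X))
        ≈⟨ alt-cong (N ℕ.+ M) (λ k → trans (*-congˡ (P-neg (E-additive (+ toℕ k)) X)) (sym (-‿distribʳ-* _ _))) ⟩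
      alt (N ℕ.+ M) (λ k → - (h (upBy (toℕ k) d) * E (+ toℕ k) X))
        ≈⟨ alt-additive neg-additive (N ℕ.+ M) _ ⟨
      - bernSum (N ℕ.+ M) d (λ j → E (+ j) X) ≈⟨ -‿cong (hyp M d) ⟩
      - B d X ≈⟨ P-neg (B-additive d) X ⟨
      B d (- X) ∎)
    (1 , λ M d → begin
      h d * E 0ℤ 1# - alt M (λ k → h (upBy (toℕ k) (up d)) * E (+ suc (toℕ k)) 1#)
        ≈⟨ -‿cong₂ (*-congˡ E-1) (alt-0 M (λ k → trans (*-congˡ (E-1-suc (toℕ k))) (zeroʳ _))) ⟩
      h d * 1# - 0# ≈⟨ trans (x-0≈x _) (*-identityʳ _) ⟩
      h d ≈⟨ B-1 d ⟨
      B d 1# ∎)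
    (λ a {X} (N , hyp) → suc N , λ M d → begin
      bernSum (suc (N ℕ.+ M)) d (λ j → E (+ j) (h a * X))
        ≈⟨ alt-cong (suc (N ℕ.+ M)) (λ k → trans (*-congˡ (E-h (+ toℕ k) a X))
             (solve 5 (λ x a a′ y z → x :* (a :* y :+ a′ :* z) := a :* (x :* y) :+ a′ :* (x :* z)) refl (h (upBy (toℕ k) d)) (h a) (h (dn a)) _ _)) ⟩
      alt (suc (N ℕ.+ M)) (λ k → h a * (h (upBy (toℕ k) d) * E (+ toℕ k) X) + h (dn a) * (h (upBy (toℕ k) d) * E (dn (+ toℕ k)) X))
        ≈⟨ alt-+ (suc (N ℕ.+ M)) (λ k → h a * (h (upBy (toℕ k) d) * E (+ toℕ k) X)) (λ k → h (dn a) * (h (upBy (toℕ k) d) * E (dn (+ toℕ k)) X)) ⟩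
      alt (suc (N ℕ.+ M)) (λ k → h a * (h (upBy (toℕ k) d) * E (+ toℕ k) X)) +
      alt (suc (N ℕ.+ M)) (λ k → h (dn a) * (h (upBy (toℕ k) d) * E (dn (+ toℕ k)) X))
        ≈⟨ +-cong (alt-additive (*-additive (h a)) (suc (N ℕ.+ M)) (λ k → h (upBy (toℕ k) d) * E (+ toℕ k) X))
             (alt-additive (*-additive (h (dn a))) (suc (N ℕ.+ M)) (λ k → h (upBy (toℕ k) d) * E (dn (+ toℕ k)) X)) ⟨
      h a * bernSum (suc (N ℕ.+ M)) d (λ j → E (+ j) X) + h (dn a) * (h d * E -[1+ 0 ] X - bernSum (N ℕ.+ M) (up d) (λ j → E (+ j) X))
        ≈⟨ +-cong (*-congˡ (≡.subst (λ n → bernSum n d (λ j → E (+ j) X) ≈ B d X) (ℕₚ.+-suc N M) (hyp (suc M) d)))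
             (*-congˡ (-‿cong₂ (trans (*-congˡ (E-neg 0 X)) (zeroʳ _)) (hyp M (up d)))) ⟩
      h a * B d X + h (dn a) * (0# - B (up d) X)
        ≈⟨ +-congˡ (trans (*-congˡ (+-identityˡ _)) (sym (-‿distribʳ-* _ _))) ⟩
      h a * B d X - h (dn a) * B (up d) X ≈⟨ B-h d a X ⟨
      B d (h a * X) ∎)
    where
    neg-additive : Additive (-_)
    neg-additive = record { P-cong = -‿cong ; P-+ = λ X Y → solve 2 (λ x y → :- (x :+ y) := (:- x) :+ (:- y)) refl X Y }

  B-as-sum-bounded : ∀ n X → (∀ j → E (+ (n ℕ.+ j)) X ≈ 0#) → ∀ d → bernSum n d (λ j → E (+ j) X) ≈ B d X
  B-as-sum-bounded n X van d with B-as-sum X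
  ... | N , hyp = begin
    bernSum n d (λ j → E (+ j) X)            ≈⟨ bernSum-truncate n N d (λ j → E (+ j) X) van ⟨
    bernSum (n ℕ.+ N) d (λ j → E (+ j) X)    ≡⟨ ≡.cong (λ m → bernSum m d (λ j → E (+ j) X)) (ℕₚ.+-comm n N) ⟩
    bernSum (N ℕ.+ n) d (λ j → E (+ j) X)    ≈⟨ hyp n d ⟩
    B d X ∎

  e : ℕ → Carrier
  e zero = 1#
  e (suc n) = B 1ℤ (e n)

  eℤ : ℤ → Carrier
  eℤ (+ n) = e n
  eℤ -[1+ n ] = 0#

  B-0-e : ∀ n → B 0ℤ (e (suc n)) ≈ 0#
  B-0-e n = B-B-up 0ℤ (e n)

  B-0-1 : B 0ℤ 1# ≈ 1#
  B-0-1 = trans (B-1 0ℤ) h-zero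

  -- Both sides are e_{a-i}. This reindexes the Bernstein sum of `e (suc a)` in `B-e-suc`.
  E-e-suc : ∀ a i → E (+ suc i) (e (suc a)) ≈ E (+ i) (e a)
  E-e-suc zero zero = begin
    E 1ℤ (B 1ℤ 1#)                   ≈⟨ E-B 1ℤ 1ℤ 1# ⟩
    B 1ℤ (E 1ℤ 1#) + B 0ℤ (E 0ℤ 1#)  ≈⟨ +-cong (trans (B-cong 1ℤ (E-1-suc 0)) (P-0 (B-additive 1ℤ))) (trans (B-cong 0ℤ E-1) B-0-1) ⟩
    0# + 1#                          ≈⟨ trans (+-identityˡ 1#) (sym E-1) ⟩
    E 0ℤ 1# ∎
  E-e-suc zero (suc i) = begin
    E (+ suc (suc i)) (B 1ℤ 1#)                             ≈⟨ E-B (+ suc (suc i)) 1ℤ 1# ⟩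
    B 1ℤ (E (+ suc (suc i)) 1#) + B 0ℤ (E (+ suc i) 1#)
      ≈⟨ +-cong (trans (B-cong 1ℤ (E-1-suc (suc i))) (P-0 (B-additive 1ℤ))) (trans (B-cong 0ℤ (E-1-suc i)) (P-0 (B-additive 0ℤ))) ⟩
    0# + 0#                          ≈⟨ trans (+-identityˡ 0#) (sym (E-1-suc i)) ⟩
    E (+ suc i) 1# ∎
  E-e-suc (suc a) zero = begin
    E 1ℤ (B 1ℤ (e (suc a)))                               ≈⟨ E-B 1ℤ 1ℤ (e (suc a)) ⟩
    B 1ℤ (E 1ℤ (e (suc a))) + B 0ℤ (E 0ℤ (e (suc a)))     ≈⟨ +-cong (B-cong 1ℤ (trans (E-e-suc a 0) (E-zero (e a)))) (trans (B-cong 0ℤ (E-zero _)) (B-0-e a)) ⟩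
    e (suc a) + 0#                                        ≈⟨ trans (+-identityʳ _) (sym (E-zero _)) ⟩
    E 0ℤ (e (suc a)) ∎
  E-e-suc (suc a) (suc i) = begin
    E (+ suc (suc i)) (B 1ℤ (e (suc a)))                               ≈⟨ E-B (+ suc (suc i)) 1ℤ (e (suc a)) ⟩
    B 1ℤ (E (+ suc (suc i)) (e (suc a))) + B 0ℤ (E (+ suc i) (e (suc a)))
      ≈⟨ +-cong (B-cong 1ℤ (E-e-suc a (suc i))) (B-cong 0ℤ (E-e-suc a i)) ⟩
    B 1ℤ (E (+ suc i) (e a)) + B 0ℤ (E (+ i) (e a))                     ≈⟨ E-B (+ suc i) 1ℤ (e a) ⟨
    E (+ suc i) (e (suc a)) ∎

  E-e-vanish : ∀ a j → E (+ suc (a ℕ.+ j)) (e a) ≈ 0#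
  E-e-vanish zero j = E-1-suc j
  E-e-vanish (suc a) j = trans (E-e-suc a (suc (a ℕ.+ j))) (E-e-vanish a j)

  -- For d ≥ 1, `B d (e k)` is the hook Schur function s_{(d,1^k)}, and this is h_d e_{a+1} =
  -- s_{(d,1^{a+1})} + s_{(d+1,1^a)}: behind its first term, the Bernstein sum is the one for `up d`
  -- and `e a`.
  B-e-suc : ∀ d a → B d (e (suc a)) ≈ h d * e (suc a) - B (up d) (e a)
  B-e-suc d a = begin
    B d (e (suc a))
      ≈⟨ B-as-sum-bounded (suc (suc a)) (e (suc a)) (E-e-vanish (suc a)) d ⟨
    h d * E 0ℤ (e (suc a)) - bernSum (suc a) (up d) (λ j → E (+ suc j) (e (suc a)))
      ≈⟨ -‿cong₂ (*-congˡ (E-zero _)) (bernSum-cong (suc a) (up d) (E-e-suc a)) ⟩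
    h d * e (suc a) - bernSum (suc a) (up d) (λ j → E (+ j) (e a))
      ≈⟨ -‿cong₂ refl (B-as-sum-bounded (suc a) (e a) (E-e-vanish a) (up d)) ⟩
    h d * e (suc a) - B (up d) (e a) ∎

  -- Multiplication by `eℤ a` commutes with multiplication by `h c`, so both sides follow the
  -- recursion `B-h` in X. The content lies in the value at 1, which is the hook relation `B-e-suc`.
  e-B : ∀ a d X → eℤ a * B d X ≈ B d (eℤ a * X) + B (up d) (eℤ (dn a) * X)
  e-B a d = additive-ind {ℤ × ℤ} (λ (a , d) X → eℤ a * B d X) (λ (a , d) X → B d (eℤ a * X) + B (up d) (eℤ (dn a) * X))
    (λ (a , d) → ∘-additive (*-additive (eℤ a)) (B-additive d))
    (λ (a , d) → +-additive (∘-additive (B-additive d) (*-additive (eℤ a))) (∘-additive (B-additive (up d)) (*-additive (eℤ (dn a)))))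
    (λ (a , d) → trans (*-congˡ (B-1 d)) (trans (base a d) (+-cong (B-cong d (sym (*-identityʳ _))) (B-cong (up d) (sym (*-identityʳ _))))))
    step (a , d)
    where
    base : ∀ a d → eℤ a * h d ≈ B d (eℤ a) + B (up d) (eℤ (dn a))
    base (+ zero) d = trans (*-identityˡ _) (trans (sym (B-1 d)) (sym (trans (+-congˡ (P-0 (B-additive (up d)))) (+-identityʳ _))))
    base (+ suc n) d = begin
      e (suc n) * h d ≈⟨ solve 3 (λ x y z → x :* y := (y :* x :- z) :+ z) refl (e (suc n)) (h d) (B (up d) (e n)) ⟩
      (h d * e (suc n) - B (up d) (e n)) + B (up d) (e n) ≈⟨ +-congʳ (B-e-suc d n) ⟨
      B d (e (suc n)) + B (up d) (e n) ∎
    base -[1+ n ] d = trans (zeroˡ _) (sym (trans (+-cong (P-0 (B-additive d)) (P-0 (B-additive (up d)))) (+-identityʳ 0#)))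
    step : ∀ c X → (∀ ((a , d) : ℤ × ℤ) → eℤ a * B d X ≈ B d (eℤ a * X) + B (up d) (eℤ (dn a) * X)) →
           ∀ ((a , d) : ℤ × ℤ) → eℤ a * B d (h c * X) ≈ B d (eℤ a * (h c * X)) + B (up d) (eℤ (dn a) * (h c * X))
    step c X IH (a , d) = begin
      eℤ a * B d (h c * X)
        ≈⟨ *-congˡ (B-h d c X) ⟩
      eℤ a * (h c * B d X - h (dn c) * B (up d) X)
        ≈⟨ solve 5 (λ e x x′ y z → e :* (x :* y :- x′ :* z) := x :* (e :* y) :- x′ :* (e :* z)) refl _ _ _ _ _ ⟩
      h c * (eℤ a * B d X) - h (dn c) * (eℤ a * B (up d) X)
        ≈⟨ -‿cong₂ (*-congˡ (IH (a , d))) (*-congˡ (IH (a , up d))) ⟩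
      h c * (B d (eℤ a * X) + B (up d) (eℤ (dn a) * X)) - h (dn c) * (B (up d) (eℤ a * X) + B (up (up d)) (eℤ (dn a) * X))
        ≈⟨ solve 6 (λ x x′ y z w t → x :* (y :+ z) :- x′ :* (w :+ t) := (x :* y :- x′ :* w) :+ (x :* z :- x′ :* t)) refl _ _ _ _ _ _ ⟩
      (h c * B d (eℤ a * X) - h (dn c) * B (up d) (eℤ a * X)) + (h c * B (up d) (eℤ (dn a) * X) - h (dn c) * B (up (up d)) (eℤ (dn a) * X))
        ≈⟨ +-cong (B-h d c _) (B-h (up d) c _) ⟨
      B d (h c * (eℤ a * X)) + B (up d) (h c * (eℤ (dn a) * X))
        ≈⟨ +-cong (B-cong d (x*yz (h c) (eℤ a) X)) (B-cong (up d) (x*yz (h c) (eℤ (dn a)) X)) ⟩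
      B d (eℤ a * (h c * X)) + B (up d) (eℤ (dn a) * (h c * X)) ∎
      where
      x*yz : ∀ x y z → x * (y * z) ≈ y * (x * z)
      x*yz = solve 3 (λ x y z → x :* (y :* z) := y :* (x :* z)) refl

-- Subset sums, determinants and the Jacobi-Trudi identity

module Determinants (A : BernsteinAlgebra) where
  open BernsteinAlgebra A
  open Theory A
  open Additive
  open import Relation.Binary.Reasoning.Setoid setoid
  open RingSolver commRing const using (solve; _:=_; _:+_; _:-_)

  pick : ℤ → Carrier → Carrier
  pick (+ zero) x = x
  pick (+ suc _) x = 0#
  pick -[1+ _ ] x = 0#

  pick-additive : ∀ j → Additive (pick j)
  pick-additive (+ zero) = id-additive
  pick-additive (+ suc _) = 0-additive
  pick-additive -[1+ _ ] = 0-additive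

  pick-∘ : ∀ {P} → Additive P → ∀ j x → P (pick j x) ≈ pick j (P x)
  pick-∘ p (+ zero) x = refl
  pick-∘ p (+ suc _) x = P-0 p
  pick-∘ p -[1+ _ ] x = P-0 p

  -- The sum of φ T over the j-element subsets T of an n-element set (so 0 for j < 0).
  Σ⊆ : ∀ n → ℤ → (Vec Bool n → Carrier) → Carrier
  Σ⊆ zero j φ = pick j (φ [])
  Σ⊆ (suc n) j φ = Σ⊆ n j (φ ∘ (false ∷_)) + Σ⊆ n (dn j) (φ ∘ (true ∷_))

  Σ⊆-cong : ∀ n j {φ ψ : Vec Bool n → Carrier} → (∀ T → φ T ≈ ψ T) → Σ⊆ n j φ ≈ Σ⊆ n j ψ
  Σ⊆-cong zero j eq = P-cong (pick-additive j) (eq [])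
  Σ⊆-cong (suc n) j eq = +-cong (Σ⊆-cong n j (eq ∘ (false ∷_))) (Σ⊆-cong n (dn j) (eq ∘ (true ∷_)))

  Σ⊆-0 : ∀ n j {φ : Vec Bool n → Carrier} → (∀ T → φ T ≈ 0#) → Σ⊆ n j φ ≈ 0#
  Σ⊆-0 zero j eq = trans (P-cong (pick-additive j) (eq [])) (P-0 (pick-additive j))
  Σ⊆-0 (suc n) j eq = trans (+-cong (Σ⊆-0 n j (eq ∘ (false ∷_))) (Σ⊆-0 n (dn j) (eq ∘ (true ∷_)))) (+-identityʳ 0#)

  Σ⊆-additive : ∀ {P} → Additive P → ∀ n j φ → P (Σ⊆ n j φ) ≈ Σ⊆ n j (P ∘ φ)
  Σ⊆-additive p zero j φ = pick-∘ p j (φ [])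
  Σ⊆-additive p (suc n) j φ = trans (P-+ p _ _) (+-cong (Σ⊆-additive p n j _) (Σ⊆-additive p n (dn j) _))

  Σ⊆-- : ∀ n j φ ψ → Σ⊆ n j (λ T → φ T - ψ T) ≈ Σ⊆ n j φ - Σ⊆ n j ψ
  Σ⊆-- zero j φ ψ = P-- (pick-additive j) _ _
  Σ⊆-- (suc n) j φ ψ = trans (+-cong (Σ⊆-- n j _ _) (Σ⊆-- n (dn j) _ _))
    (solve 4 (λ a b c d → (a :- b) :+ (c :- d) := (a :+ c) :- (b :+ d)) refl _ _ _ _)

  Σ⊆-neg : ∀ n m φ → Σ⊆ n -[1+ m ] φ ≈ 0#
  Σ⊆-neg zero m φ = refl
  Σ⊆-neg (suc n) m φ = trans (+-cong (Σ⊆-neg n m _) (Σ⊆-neg n (suc m) _)) (+-identityʳ 0#)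

  Σ⊆-large : ∀ n m φ → Σ⊆ n (+ suc (n ℕ.+ m)) φ ≈ 0#
  Σ⊆-large zero m φ = refl
  Σ⊆-large (suc n) m φ = trans (+-cong (≡.subst (λ k → Σ⊆ n (+ suc k) (φ ∘ (false ∷_)) ≈ 0#) (ℕₚ.+-suc n m) (Σ⊆-large n (suc m) _))
    (Σ⊆-large n m _)) (+-identityʳ 0#)

  Σ⊆-full : ∀ n φ → Σ⊆ n (+ n) φ ≈ φ (Vec.replicate n true)
  Σ⊆-full zero φ = refl
  Σ⊆-full (suc n) φ = trans (+-cong (≡.subst (λ k → Σ⊆ n (+ suc k) (φ ∘ (false ∷_)) ≈ 0#) (ℕₚ.+-identityʳ n) (Σ⊆-large n 0 _)) (Σ⊆-full n _)) (+-identityˡ _)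

  -- The definition splits on the first position; the Laplace term through column k needs the split
  -- at k.
  Σ⊆-insertAt : ∀ n j (k : Fin (suc n)) φ →
    Σ⊆ (suc n) j φ ≈ Σ⊆ n j (λ T → φ (insertAt T k false)) + Σ⊆ n (dn j) (λ T → φ (insertAt T k true))
  Σ⊆-insertAt n j Fin.zero φ = refl
  Σ⊆-insertAt (suc n) j (Fin.suc k) φ =
    trans (+-cong (Σ⊆-insertAt n j k (φ ∘ (false ∷_))) (Σ⊆-insertAt n (dn j) k (φ ∘ (true ∷_))))
      (solve 4 (λ a b c d → (a :+ b) :+ (c :+ d) := (a :+ c) :+ (b :+ d)) refl _ _ _ _)

  Σ⊆-alt : ∀ m n j (φ : Fin m → Vec Bool n → Carrier) → alt m (λ k → Σ⊆ n j (φ k)) ≈ Σ⊆ n j (λ T → alt m (λ k → φ k T))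
  Σ⊆-alt zero n j φ = sym (Σ⊆-0 n j (λ _ → refl))
  Σ⊆-alt (suc m) n j φ = trans (-‿cong₂ refl (Σ⊆-alt m n j (φ ∘ Fin.suc))) (sym (Σ⊆-- n j _ _))

  det : ∀ n → (Fin n → Fin n → Carrier) → Carrier
  det zero M = 1#
  det (suc n) M = alt (suc n) (λ j → M Fin.zero j * det n (λ a b → M (Fin.suc a) (punchIn j b)))

  det-cong : ∀ n {M N : Fin n → Fin n → Carrier} → (∀ a b → M a b ≈ N a b) → det n M ≈ det n N
  det-cong zero eq = refl
  det-cong (suc n) eq = alt-cong (suc n) (λ j → *-cong (eq Fin.zero j) (det-cong n (λ a b → eq (Fin.suc a) (punchIn j b))))

  det-zero-row : ∀ n (M : Fin n → Fin n → Carrier) a → (∀ b → M a b ≈ 0#) → det n M ≈ 0#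
  det-zero-row (suc n) M a eq = alt-0 (suc n) (term a eq)
    where
    minor : Fin (suc n) → Carrier
    minor j = det n (λ a b → M (Fin.suc a) (punchIn j b))
    term : ∀ a → (∀ b → M a b ≈ 0#) → ∀ j → M Fin.zero j * minor j ≈ 0#
    term Fin.zero eq j = trans (*-congʳ (eq j)) (zeroˡ (minor j))
    term (Fin.suc a) eq j = trans (*-congˡ (det-zero-row n (λ a b → M (Fin.suc a) (punchIn j b)) a (λ b → eq (punchIn j b)))) (zeroʳ (M Fin.zero j))

  -- The rule `E-h` with f in place of `h`. Being linear in f, it holds for rows of h's and also for
  -- the rows of k's in g_γ.
  ShiftLinear : (ℤ → Carrier) → Set
  ShiftLinear f = ∀ i c X → E i (f c * X) ≈ f c * E i X + f (dn c) * E (dn i) X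

  -- Columns carry integer labels, so that lowering every index in a column means lowering its
  -- label.
  colDet : ∀ n → (Fin n → ℤ → Carrier) → (Fin n → ℤ) → Carrier
  colDet n fs c = det n (λ a b → fs a (c b))

  colDet-cong : ∀ n fs {c c′ : Fin n → ℤ} → (∀ b → c b ≡ c′ b) → colDet n fs c ≈ colDet n fs c′
  colDet-cong n fs eq = det-cong n (λ a b → reflexive (≡.cong (fs a) (eq b)))

  dnIf : Bool → ℤ → ℤ
  dnIf t c = if t then dn c else c

  shift : ∀ {n} → Vec Bool n → (Fin n → ℤ) → Fin n → ℤ
  shift T c b = dnIf (lookup T b) (c b)

  -- Each term of the expanded determinant takes one factor from every column, and each factor is
  -- lowered at most once. So E_j lowers j of the columns, in all possible ways.
  E-colDet : ∀ n fs → (∀ a → ShiftLinear (fs a)) → ∀ j c → E j (colDet n fs c) ≈ Σ⊆ n j (λ T → colDet n fs (shift T c))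
  E-colDet zero fs lin (+ zero) c = E-1
  E-colDet zero fs lin (+ suc j) c = E-1-suc j
  E-colDet zero fs lin -[1+ j ] c = E-1-neg j
  E-colDet (suc n) fs lin j c = begin
    E j (alt (suc n) (λ k → f (c k) * D (c ∘ punchIn k)))
      ≈⟨ alt-additive (E-additive j) (suc n) (λ k → f (c k) * D (c ∘ punchIn k)) ⟩
    alt (suc n) (λ k → E j (f (c k) * D (c ∘ punchIn k)))
      ≈⟨ alt-cong (suc n) term ⟩
    alt (suc n) (λ k → Σ⊆ (suc n) j (λ T → f (shift T c k) * D (shift T c ∘ punchIn k)))
      ≈⟨ Σ⊆-alt (suc n) (suc n) j (λ k T → f (shift T c k) * D (shift T c ∘ punchIn k)) ⟩
    Σ⊆ (suc n) j (λ T → colDet (suc n) fs (shift T c)) ∎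
    where
    f = fs Fin.zero
    D = colDet n (fs ∘ Fin.suc)
    term : ∀ k → E j (f (c k) * D (c ∘ punchIn k)) ≈ Σ⊆ (suc n) j (λ T → f (shift T c k) * D (shift T c ∘ punchIn k))
    term k = begin
      E j (f (c k) * D (c ∘ punchIn k))
        ≈⟨ lin Fin.zero j (c k) _ ⟩
      f (c k) * E j (D (c ∘ punchIn k)) + f (dn (c k)) * E (dn j) (D (c ∘ punchIn k))
        ≈⟨ +-cong (half j false) (half (dn j) true) ⟩
      Σ⊆ n j (λ T → f (shift (insertAt T k false) c k) * D (shift (insertAt T k false) c ∘ punchIn k)) +
      Σ⊆ n (dn j) (λ T → f (shift (insertAt T k true) c k) * D (shift (insertAt T k true) c ∘ punchIn k))
        ≈⟨ Σ⊆-insertAt n j k (λ T → f (shift T c k) * D (shift T c ∘ punchIn k)) ⟨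
      Σ⊆ (suc n) j (λ T → f (shift T c k) * D (shift T c ∘ punchIn k)) ∎
      where
      half : ∀ j t → f (dnIf t (c k)) * E j (D (c ∘ punchIn k)) ≈
             Σ⊆ n j (λ T → f (shift (insertAt T k t) c k) * D (shift (insertAt T k t) c ∘ punchIn k))
      half j t = begin
        f (dnIf t (c k)) * E j (D (c ∘ punchIn k))
          ≈⟨ *-congˡ (E-colDet n (fs ∘ Fin.suc) (lin ∘ Fin.suc) j (c ∘ punchIn k)) ⟩
        f (dnIf t (c k)) * Σ⊆ n j (λ T → D (shift T (c ∘ punchIn k)))
          ≈⟨ Σ⊆-additive (*-additive (f (dnIf t (c k)))) n j (λ T → D (shift T (c ∘ punchIn k))) ⟩
        Σ⊆ n j (λ T → f (dnIf t (c k)) * D (shift T (c ∘ punchIn k)))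
          ≈⟨ Σ⊆-cong n j (λ T → *-cong
               (reflexive (≡.cong (λ s → f (dnIf s (c k))) (≡.sym (Vecₚ.insertAt-lookup T k t))))
               (colDet-cong n (fs ∘ Fin.suc) (λ b → ≡.cong (λ s → dnIf s (c (punchIn k b))) (≡.sym (Vecₚ.insertAt-punchIn T k t b))))) ⟩
        Σ⊆ n j (λ T → f (shift (insertAt T k t) c k) * D (shift (insertAt T k t) c ∘ punchIn k)) ∎

  -- Neighbours suffice: lowering some labels of a consecutive run by one creates coincidences only
  -- between neighbours.
  Repeats : ∀ n → (Fin n → ℤ) → Set
  Repeats zero c = ⊥
  Repeats (suc zero) c = ⊥
  Repeats (suc (suc n)) c = c Fin.zero ≡ c (Fin.suc Fin.zero) ⊎ Repeats (suc n) (c ∘ Fin.suc)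

  record Alternating n (φ : (Fin n → ℤ) → Carrier) : Set where
    field
      ext : ∀ {c c′} → (∀ b → c b ≡ c′ b) → φ c ≈ φ c′
      van : ∀ {c} → Repeats n c → φ c ≈ 0#
  open Alternating

  consF : ∀ {n} → ℤ → (Fin n → ℤ) → Fin (suc n) → ℤ
  consF x c Fin.zero = x
  consF x c (Fin.suc b) = c b

  consF-alternating : ∀ n {φ} → Alternating (suc n) φ → ∀ x → Alternating n (φ ∘ consF x)
  consF-alternating n al x = record
    { ext = λ eq → ext al λ { Fin.zero → ≡.refl ; (Fin.suc b) → eq b }
    ; van = λ r → van al (rep n r) }
    where
    rep : ∀ n {c} → Repeats n c → Repeats (suc n) (consF x c)
    rep (suc (suc n)) r = inj₂ r

  -- If the first two columns agree, the first two Laplace terms cancel and every further minor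
  -- keeps both columns. If the coincidence comes later, the first minor vanishes and the rest is
  -- the same statement with the first label frozen by `consF`.
  alt-vanish : ∀ n (f : ℤ → Carrier) φ → Alternating n φ → ∀ c → Repeats (suc n) c → alt (suc n) (λ k → f (c k) * φ (c ∘ punchIn k)) ≈ 0#
  alt-vanish (suc n) f φ al c (inj₂ r) = begin
    f (c Fin.zero) * φ (c ∘ Fin.suc) - alt (suc n) (λ k → f (c (Fin.suc k)) * φ (c ∘ punchIn (Fin.suc k)))
      ≈⟨ -‿cong₂ (trans (*-congˡ (van al r)) (zeroʳ _)) (alt-cong (suc n) term) ⟩
    0# - alt (suc n) (λ k → f (c (Fin.suc k)) * φ (consF (c Fin.zero) (c ∘ Fin.suc ∘ punchIn k)))
      ≈⟨ -‿cong₂ refl (alt-vanish n f _ (consF-alternating n al (c Fin.zero)) (c ∘ Fin.suc) r) ⟩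
    0# - 0# ≈⟨ -‿inverseʳ 0# ⟩
    0# ∎
    where
    term : ∀ k → f (c (Fin.suc k)) * φ (c ∘ punchIn (Fin.suc k)) ≈ f (c (Fin.suc k)) * φ (consF (c Fin.zero) (c ∘ Fin.suc ∘ punchIn k))
    term k = *-congˡ (ext al λ { Fin.zero → ≡.refl ; (Fin.suc b) → ≡.refl })
  alt-vanish (suc n) f φ al c (inj₁ eq) = begin
    f (c Fin.zero) * φ (c ∘ Fin.suc) - (f (c (Fin.suc Fin.zero)) * φ (c ∘ punchIn (Fin.suc Fin.zero)) - rest)
      ≈⟨ -‿cong₂ (*-cong (reflexive (≡.cong f eq)) (ext al λ { Fin.zero → ≡.sym eq ; (Fin.suc b) → ≡.refl })) (-‿cong₂ refl (alt-0 n (λ k → trans (*-congˡ (van al (rep n c eq k))) (zeroʳ _)))) ⟩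
    f (c (Fin.suc Fin.zero)) * φ (c ∘ punchIn (Fin.suc Fin.zero)) - (f (c (Fin.suc Fin.zero)) * φ (c ∘ punchIn (Fin.suc Fin.zero)) - 0#)
      ≈⟨ trans (+-congˡ (-‿cong (x-0≈x _))) (-‿inverseʳ _) ⟩
    0# ∎
    where
    rest = alt n (λ k → f (c (Fin.suc (Fin.suc k))) * φ (c ∘ punchIn (Fin.suc (Fin.suc k))))
    rep : ∀ n (c : Fin (suc (suc n)) → ℤ) → c Fin.zero ≡ c (Fin.suc Fin.zero) → ∀ k → Repeats (suc n) (c ∘ punchIn (Fin.suc (Fin.suc k)))
    rep (suc n) c eq k = inj₁ eq

  colDet-alternating : ∀ n fs → Alternating n (colDet n fs)
  colDet-alternating n fs = record { ext = colDet-cong n fs ; van = vanish n fs }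
    where
    vanish : ∀ n fs {c} → Repeats n c → colDet n fs c ≈ 0#
    vanish (suc n) fs {c} r = alt-vanish n (fs Fin.zero) (colDet n (fs ∘ Fin.suc)) (colDet-alternating n (fs ∘ Fin.suc)) c r

  Consecutive : ∀ {n} → (Fin (suc n) → ℤ) → Set
  Consecutive {n} c = ∀ (b : Fin n) → dn (c (Fin.suc b)) ≡ c (inject₁ b)

  -- Lowering the first movable column would make it equal to the fixed one before it. So it stays
  -- and becomes the fixed one in turn, and only the empty subset survives.
  Σ⊆-fixed-head : ∀ n j φ → Alternating (suc n) φ → ∀ c → Consecutive c →
    Σ⊆ n j (λ T → φ (consF (c Fin.zero) (shift T (c ∘ Fin.suc)))) ≈ pick j (φ c)
  Σ⊆-fixed-head zero j φ al c con = P-cong (pick-additive j) (ext al λ { Fin.zero → ≡.refl })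
  Σ⊆-fixed-head (suc n) j φ al c con = begin
    Σ⊆ n j (λ T → φ (consF c₀ (shift (false ∷ T) (c ∘ Fin.suc)))) + Σ⊆ n (dn j) (λ T → φ (consF c₀ (shift (true ∷ T) (c ∘ Fin.suc))))
      ≈⟨ +-cong (Σ⊆-cong n j λ T → ext al λ { Fin.zero → ≡.refl ; (Fin.suc Fin.zero) → ≡.refl ; (Fin.suc (Fin.suc b)) → ≡.refl })
           (Σ⊆-0 n (dn j) λ T → van al (inj₁ (≡.sym (con Fin.zero)))) ⟩
    Σ⊆ n j (λ T → φ (consF c₀ (consF (c (Fin.suc Fin.zero)) (shift T (c ∘ Fin.suc ∘ Fin.suc))))) + 0#
      ≈⟨ +-identityʳ _ ⟩
    Σ⊆ n j (λ T → φ (consF c₀ (consF (c (Fin.suc Fin.zero)) (shift T (c ∘ Fin.suc ∘ Fin.suc)))))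
      ≈⟨ Σ⊆-fixed-head n j (φ ∘ consF c₀) (consF-alternating (suc n) al c₀) (c ∘ Fin.suc) (con ∘ Fin.suc) ⟩
    pick j (φ (consF c₀ (c ∘ Fin.suc)))
      ≈⟨ P-cong (pick-additive j) (ext al λ { Fin.zero → ≡.refl ; (Fin.suc b) → ≡.refl }) ⟩
    pick j (φ c) ∎
    where c₀ = c Fin.zero

  -- Among the shifts of consecutive columns c₁,…,cₙ by j-subsets, only {1,…,j} gives distinct columns.
  Σ⊆-consecutive : ∀ n φ → Alternating n φ → ∀ c → Consecutive c → ∀ j →
    Σ⊆ n (+ toℕ j) (λ T → φ (shift T (c ∘ Fin.suc))) ≈ φ (c ∘ punchIn j)
  Σ⊆-consecutive zero φ al c con Fin.zero = ext al λ ()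
  Σ⊆-consecutive (suc n) φ al c con j = begin
    Σ⊆ n (+ toℕ j) (λ T → φ (shift (false ∷ T) (c ∘ Fin.suc))) + Σ⊆ n (dn (+ toℕ j)) (λ T → φ (shift (true ∷ T) (c ∘ Fin.suc)))
      ≈⟨ +-cong (trans (Σ⊆-cong n (+ toℕ j) λ T → ext al λ { Fin.zero → ≡.refl ; (Fin.suc b) → ≡.refl })
            (Σ⊆-fixed-head n (+ toℕ j) φ al (c ∘ Fin.suc) (con ∘ Fin.suc)))
          (Σ⊆-cong n (dn (+ toℕ j)) λ T → ext al λ { Fin.zero → con Fin.zero ; (Fin.suc b) → ≡.refl }) ⟩
    pick (+ toℕ j) (φ (c ∘ Fin.suc)) + Σ⊆ n (dn (+ toℕ j)) (λ T → φ (consF (c Fin.zero) (shift T (c ∘ Fin.suc ∘ Fin.suc))))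
      ≈⟨ cases j ⟩
    φ (c ∘ punchIn j) ∎
    where
    cases : ∀ j → pick (+ toℕ j) (φ (c ∘ Fin.suc)) + Σ⊆ n (dn (+ toℕ j)) (λ T → φ (consF (c Fin.zero) (shift T (c ∘ Fin.suc ∘ Fin.suc))))
                  ≈ φ (c ∘ punchIn j)
    cases Fin.zero = trans (+-congˡ (Σ⊆-neg n 0 _)) (+-identityʳ _)
    cases (Fin.suc j) = trans (+-identityˡ _) (trans
      (Σ⊆-consecutive n (φ ∘ consF (c Fin.zero)) (consF-alternating n al (c Fin.zero)) (c ∘ Fin.suc) (con ∘ Fin.suc) j)
      (ext al λ { Fin.zero → ≡.refl ; (Fin.suc b) → ≡.refl }))

  -- Lowering the first j of the labels c₁,...,cₙ gives c₀,...,cₙ without c_j. All minors along a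
  -- first row are thus e_j^⊥ of the single minor without column 0, which makes a Laplace expansion
  -- a Bernstein sum.
  E-colDet-minor : ∀ n fs → (∀ a → ShiftLinear (fs a)) → ∀ c → Consecutive c → ∀ j →
    colDet n fs (c ∘ punchIn j) ≈ E (+ toℕ j) (colDet n fs (c ∘ Fin.suc))
  E-colDet-minor n fs lin c con j = sym (trans (E-colDet n fs lin (+ toℕ j) (c ∘ Fin.suc))
    (Σ⊆-consecutive n (colDet n fs) (colDet-alternating n fs) c con j))

  E-colDet-large : ∀ n fs → (∀ a → ShiftLinear (fs a)) → ∀ c m → E (+ suc (n ℕ.+ m)) (colDet n fs c) ≈ 0#
  E-colDet-large n fs lin c m = trans (E-colDet n fs lin _ c) (Σ⊆-large n m _)

  E-colDet-full : ∀ n fs → (∀ a → ShiftLinear (fs a)) → ∀ c → E (+ n) (colDet n fs c) ≈ colDet n fs (dn ∘ c)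
  E-colDet-full n fs lin c = trans (E-colDet n fs lin (+ n) c) (trans (Σ⊆-full n _)
    (colDet-cong n fs (λ b → ≡.cong (λ t → dnIf t (c b)) (Vecₚ.lookup-replicate b true))))

  schurB : ∀ n → (Fin n → ℤ) → Carrier
  schurB zero γ = 1#
  schurB (suc n) γ = B (γ Fin.zero) (schurB n (γ ∘ Fin.suc))

  upBy≡+ : ∀ k d → upBy k d ≡ d ℤ.+ + k
  upBy≡+ zero d = ≡.sym (ℤₚ.+-identityʳ d)
  upBy≡+ (suc k) d = ≡.trans (upBy≡+ k (up d)) (≡.trans (≡.cong (ℤ._+ + k) (≡.trans (up≡suc d) (ℤₚ.+-comm 1ℤ d))) (ℤₚ.+-assoc d 1ℤ (+ k)))

  h-shiftLinear : ∀ x → ShiftLinear (λ z → h (x ℤ.+ z))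
  h-shiftLinear x i c X = trans (E-h i (x ℤ.+ c) X) (+-congˡ (*-congʳ (reflexive (≡.cong h (≡.sym (+-dn x c))))))

  jacobiTrudi : ∀ n (γ : Fin n → ℤ) → det n (λ a b → h (γ a ℤ.- + toℕ a ℤ.+ + toℕ b)) ≈ schurB n γ
  jacobiTrudi zero γ = refl
  jacobiTrudi (suc n) γ = begin
    alt (suc n) (λ k → h (γ Fin.zero ℤ.- 0ℤ ℤ.+ + toℕ k) * colDet n fs (c ∘ punchIn k))
      ≈⟨ alt-cong (suc n) (λ k → *-cong (reflexive (≡.cong h (≡.trans (≡.cong (ℤ._+ + toℕ k) (ℤₚ.+-identityʳ (γ Fin.zero))) (≡.sym (upBy≡+ (toℕ k) (γ Fin.zero))))))
            (E-colDet-minor n fs lin c con k)) ⟩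
    bernSum (suc n) (γ Fin.zero) (λ j → E (+ j) (colDet n fs (c ∘ Fin.suc)))
      -- An n × n determinant is killed by e_j^⊥ for j > n, so the n+1 terms of the Laplace
      -- expansion are the whole Bernstein sum.
      ≈⟨ B-as-sum-bounded (suc n) _ (E-colDet-large n fs lin _) (γ Fin.zero) ⟩
    B (γ Fin.zero) (colDet n fs (c ∘ Fin.suc))
      ≈⟨ B-cong (γ Fin.zero) (trans (det-cong n (λ a b → reflexive (≡.cong h (index (γ (Fin.suc a)) (toℕ a) (toℕ b))))) (jacobiTrudi n (γ ∘ Fin.suc))) ⟩
    B (γ Fin.zero) (schurB n (γ ∘ Fin.suc)) ∎
    where
    c : Fin (suc n) → ℤ
    c b = + toℕ b
    fs : Fin n → ℤ → Carrier
    fs a z = h (γ (Fin.suc a) ℤ.- + suc (toℕ a) ℤ.+ z)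
    lin : ∀ a → ShiftLinear (fs a)
    lin a = h-shiftLinear (γ (Fin.suc a) ℤ.- + suc (toℕ a))
    con : Consecutive c
    con b = ≡.cong +_ (≡.sym (Finₚ.toℕ-inject₁ b))
    index : ∀ g a b → g ℤ.- + suc a ℤ.+ + suc b ≡ g ℤ.- + a ℤ.+ + b
    index g a b = S.solve 3 (λ g a b → (g S.:- (S.con 1ℤ S.:+ a)) S.:+ (S.con 1ℤ S.:+ b) S.:= (g S.:- a) S.:+ b) ≡.refl g (+ a) (+ b)
      where
      module S = +-*-Solver

-- Pieri rules, spanning by Schur functions, and adjointness

module Pieri (A : BernsteinAlgebra) where
  open Defs using (IsPartition; δ)
  open BernsteinAlgebra A
  open Theory A
  open Determinants A
  open Additive
  open RingProperties ring using (-‿distribʳ-*)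
  open import Relation.Binary.Reasoning.Setoid setoid
  open RingSolver commRing const using (solve; _:=_; _:+_; _:*_; _:-_)

  S : ∀ {n} → Vec ℤ n → Carrier
  S [] = 1#
  S (c ∷ cs) = B c (S cs)

  onSubset : (ℤ → ℤ) → ∀ {n} → Vec Bool n → Vec ℤ n → Vec ℤ n
  onSubset f [] [] = []
  onSubset f (t ∷ T) (c ∷ cs) = (if t then f c else c) ∷ onSubset f T cs

  E-S : ∀ {n} j (γ : Vec ℤ n) → E j (S γ) ≈ Σ⊆ n j (λ T → S (onSubset dn T γ))
  E-S (+ zero) [] = E-1
  E-S (+ suc j) [] = E-1-suc j
  E-S -[1+ j ] [] = E-1-neg j
  E-S {suc n} j (c ∷ γ) = begin
    E j (B c (S γ))                                       ≈⟨ E-B j c (S γ) ⟩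
    B c (E j (S γ)) + B (dn c) (E (dn j) (S γ))           ≈⟨ +-cong (B-cong c (E-S j γ)) (B-cong (dn c) (E-S (dn j) γ)) ⟩
    B c (Σ⊆ n j (λ T → S (onSubset dn T γ))) + B (dn c) (Σ⊆ n (dn j) (λ T → S (onSubset dn T γ)))
      ≈⟨ +-cong (Σ⊆-additive (B-additive c) n j _) (Σ⊆-additive (B-additive (dn c)) n (dn j) _) ⟩
    _ ∎

  PieriAt : ∀ {n} → ℤ → Vec ℤ n → Set
  PieriAt {n} j μ = eℤ j * S μ ≈ Σ⊆ n j (λ T → S (onSubset up T μ))

  pieri-∷ : ∀ {n} j c (μ : Vec ℤ n) → PieriAt j μ → PieriAt (dn j) μ → PieriAt j (c ∷ μ)
  pieri-∷ {n} j c μ p q = begin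
    eℤ j * B c (S μ)                                      ≈⟨ e-B j c (S μ) ⟩
    B c (eℤ j * S μ) + B (up c) (eℤ (dn j) * S μ)         ≈⟨ +-cong (B-cong c p) (B-cong (up c) q) ⟩
    B c (Σ⊆ n j (λ T → S (onSubset up T μ))) + B (up c) (Σ⊆ n (dn j) (λ T → S (onSubset up T μ)))
      ≈⟨ +-cong (Σ⊆-additive (B-additive c) n j _) (Σ⊆-additive (B-additive (up c)) n (dn j) _) ⟩
    _ ∎

  S-zeros : ∀ n → S (replicate n 0ℤ) ≈ 1#
  S-zeros zero = refl
  S-zeros (suc n) = trans (B-cong 0ℤ (S-zeros n)) B-0-1

  dn-≤ : ∀ {j n} → j ℤ.≤ + n → dn j ℤ.≤ + n
  dn-≤ {+ zero} p = ℤ.-≤+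
  dn-≤ {+ suc j} (ℤ.+≤+ p) = ℤ.+≤+ (ℕₚ.≤-trans (ℕₚ.n≤1+n j) p)
  dn-≤ { -[1+ j ]} p = ℤ.-≤+

  -- Subsets of n positions add at most n boxes, whence the bound on j.
  pieri-zeros : ∀ n j → j ℤ.≤ + n → PieriAt j (replicate n 0ℤ)
  pieri-zeros zero (+ zero) p = *-identityʳ 1#
  pieri-zeros zero (+ suc j) (ℤ.+≤+ ())
  pieri-zeros zero -[1+ j ] p = zeroˡ 1#
  pieri-zeros (suc n) j p with j ℤ.≤? + n
  ... | yes q = pieri-∷ j 0ℤ (replicate n 0ℤ) (pieri-zeros n j q) (pieri-zeros n (dn j) (dn-≤ q))
  -- Here j = n+1, and `pieri-∷` would ask for the rule with n+1 boxes on n zeros, which is false.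
  -- Only the full subset contributes, through e_{n+1} = B_1 e_n.
  ... | no q with ℤₚ.≤-antisym p (ℤₚ.i<j⇒suc[i]≤j (ℤₚ.≰⇒> q))
  ... | ≡.refl = begin
    e (suc n) * S (replicate (suc n) 0ℤ)        ≈⟨ *-congˡ (S-zeros (suc n)) ⟩
    e (suc n) * 1#                              ≈⟨ *-identityʳ _ ⟩
    B 1ℤ (e n)                                  ≈⟨ B-cong 1ℤ (trans (*-congˡ (S-zeros n)) (*-identityʳ _)) ⟨
    B 1ℤ (e n * S (replicate n 0ℤ))             ≈⟨ B-cong 1ℤ (pieri-zeros n (+ n) ℤₚ.≤-refl) ⟩
    B 1ℤ (Σ⊆ n (+ n) (λ T → S (onSubset up T (replicate n 0ℤ))))  ≈⟨ Σ⊆-additive (B-additive 1ℤ) n (+ n) _ ⟩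
    Σ⊆ n (+ n) (λ T → S (1ℤ ∷ onSubset up T (replicate n 0ℤ)))    ≈⟨ +-identityˡ _ ⟨
    0# + Σ⊆ n (+ n) (λ T → S (1ℤ ∷ onSubset up T (replicate n 0ℤ)))
      ≈⟨ +-congʳ (≡.subst (λ k → Σ⊆ n (+ suc k) (λ T → S (0ℤ ∷ onSubset up T (replicate n 0ℤ))) ≈ 0#) (ℕₚ.+-identityʳ n) (Σ⊆-large n 0 _)) ⟨
    Σ⊆ (suc n) (+ suc n) (λ T → S (onSubset up T (replicate (suc n) 0ℤ))) ∎

  pieri : ∀ {n} (μ : Vec ℤ n) N j → j ℤ.≤ + N → PieriAt j (μ Vec.++ replicate N 0ℤ)
  pieri [] N j p = pieri-zeros N j p
  pieri (c ∷ μ) N j p = pieri-∷ j c (μ Vec.++ replicate N 0ℤ) (pieri μ N j p) (pieri μ N (dn j) (dn-≤ p))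

  -- The default 0 for an empty tail supplies the end condition of the predicates below: the last
  -- entry is at least 0 in a `Dominant` vector and at least -1 in a `Near` one.
  head₀ : ∀ {n} → Vec ℤ n → ℤ
  head₀ [] = 0ℤ
  head₀ (c ∷ _) = c

  Dominant : ∀ {n} → Vec ℤ n → Set
  Dominant [] = ⊤
  Dominant (c ∷ cs) = head₀ cs ℤ.≤ c × Dominant cs

  Near : ∀ {n} → Vec ℤ n → Set
  Near [] = ⊤
  Near (c ∷ cs) = head₀ cs ℤ.≤ up c × Near cs

  ≤-up : ∀ c → c ℤ.≤ up c
  ≤-up c = ≡.subst (c ℤ.≤_) (≡.sym (up≡suc c)) (ℤₚ.i≤suc[i] c)

  up-mono-≤ : ∀ {a b} → a ℤ.≤ b → up a ℤ.≤ up b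
  up-mono-≤ {a} {b} p = ≡.subst₂ ℤ._≤_ (≡.sym (up≡suc a)) (≡.sym (up≡suc b)) (ℤₚ.+-monoʳ-≤ 1ℤ p)

  dn-≤-self : ∀ c → dn c ℤ.≤ c
  dn-≤-self c = ≡.subst (dn c ℤ.≤_) (up-dn c) (≤-up (dn c))

  near-dichotomy : ∀ {n} (α : Vec ℤ n) → Near α → Dominant α ⊎ S α ≈ 0#
  near-dichotomy [] _ = inj₁ tt
  near-dichotomy (c ∷ cs) (p , near) with near-dichotomy cs near
  ... | inj₂ z = inj₂ (trans (B-cong c z) (P-0 (B-additive c)))
  ... | inj₁ dom with head₀ cs ℤ.≤? c
  ... | yes q = inj₁ (q , dom)
  ... | no q = inj₂ (vanish cs (ℤₚ.≤-antisym p (≡.subst (ℤ._≤ head₀ cs) (≡.sym (up≡suc c)) (ℤₚ.i<j⇒suc[i]≤j (ℤₚ.≰⇒> q)))))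
    where
    vanish : ∀ {n} (cs : Vec ℤ n) → head₀ cs ≡ up c → B c (S cs) ≈ 0#
    vanish [] eq = trans (B-1 c) (≡.subst (λ d → h d ≈ 0#) (≡.trans (≡.cong dn eq) (dn-up c)) (h-neg 0))
    vanish (d ∷ ds) ≡.refl = B-B-up c (S ds)

  onSubset-up-near : ∀ {n} T (μ : Vec ℤ n) → Dominant μ → Near (onSubset up T μ)
  onSubset-up-near [] [] _ = tt
  onSubset-up-near (t ∷ T) (c ∷ cs) (p , dom) =
    ℤₚ.≤-trans (bound T cs) (ℤₚ.≤-trans (up-mono-≤ p) (up-mono-≤ (self t))) , onSubset-up-near T cs dom
    where
    bound : ∀ {n} T (cs : Vec ℤ n) → head₀ (onSubset up T cs) ℤ.≤ up (head₀ cs)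
    bound [] [] = ≤-up 0ℤ
    bound (true ∷ T) (c ∷ cs) = ℤₚ.≤-refl
    bound (false ∷ T) (c ∷ cs) = ≤-up c
    self : ∀ t → c ℤ.≤ (if t then up c else c)
    self true = ≤-up c
    self false = ℤₚ.≤-refl

  onSubset-dn-near : ∀ {n} T (γ : Vec ℤ n) → Dominant γ → Near (onSubset dn T γ)
  onSubset-dn-near [] [] _ = tt
  onSubset-dn-near (t ∷ T) (c ∷ cs) (p , dom) =
    ℤₚ.≤-trans (bound T cs) (ℤₚ.≤-trans p (self t)) , onSubset-dn-near T cs dom
    where
    bound : ∀ {n} T (cs : Vec ℤ n) → head₀ (onSubset dn T cs) ℤ.≤ head₀ cs
    bound [] [] = ℤₚ.≤-refl
    bound (true ∷ T) (c ∷ cs) = dn-≤-self c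
    bound (false ∷ T) (c ∷ cs) = ℤₚ.≤-refl
    self : ∀ t → c ℤ.≤ up (if t then dn c else c)
    self true = ℤₚ.≤-reflexive (≡.sym (up-dn c))
    self false = ≤-up c

  dn-onSubset-up : ∀ {n} T (μ : Vec ℤ n) → onSubset dn T (onSubset up T μ) ≡ μ
  dn-onSubset-up [] [] = ≡.refl
  dn-onSubset-up (true ∷ T) (c ∷ μ) = ≡.cong₂ _∷_ (dn-up c) (dn-onSubset-up T μ)
  dn-onSubset-up (false ∷ T) (c ∷ μ) = ≡.cong (c ∷_) (dn-onSubset-up T μ)

  up-onSubset-dn : ∀ {n} T (μ : Vec ℤ n) → onSubset up T (onSubset dn T μ) ≡ μ
  up-onSubset-dn [] [] = ≡.refl
  up-onSubset-dn (true ∷ T) (c ∷ μ) = ≡.cong₂ _∷_ (up-dn c) (up-onSubset-dn T μ)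
  up-onSubset-dn (false ∷ T) (c ∷ μ) = ≡.cong (c ∷_) (up-onSubset-dn T μ)

  DominantAt : ℕ → Carrier → Set
  DominantAt N X = Σ (Vec ℤ N) λ α → Dominant α × S α ≈ X

  zeros-head : ∀ N → head₀ (replicate N 0ℤ) ℤ.≤ 0ℤ
  zeros-head zero = ℤₚ.≤-refl
  zeros-head (suc N) = ℤₚ.≤-refl

  dominant-pad : ∀ {n} (α : Vec ℤ n) N → Dominant α → Dominant (α Vec.++ replicate N 0ℤ)
  dominant-pad [] zero _ = tt
  dominant-pad [] (suc N) _ = zeros-head N , dominant-pad [] N tt
  dominant-pad (c ∷ []) N (p , dom) = ℤₚ.≤-trans (zeros-head N) p , dominant-pad [] N tt
  dominant-pad (c ∷ d ∷ α) N (p , dom) = p , dominant-pad (d ∷ α) N dom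

  S-pad : ∀ {n} (α : Vec ℤ n) N → S (α Vec.++ replicate N 0ℤ) ≈ S α
  S-pad [] N = S-zeros N
  S-pad (c ∷ α) N = B-cong c (S-pad α N)

  Σ⊆-closed : (Q : Carrier → Set) → Q 0# → (∀ {X Y} → Q X → Q Y → Q (X + Y)) →
    ∀ n j φ → (∀ T → Q (φ T)) → Q (Σ⊆ n j φ)
  Σ⊆-closed Q z plus zero (+ zero) φ all = all []
  Σ⊆-closed Q z plus zero (+ suc _) φ all = z
  Σ⊆-closed Q z plus zero -[1+ _ ] φ all = z
  Σ⊆-closed Q z plus (suc n) j φ all = plus (Σ⊆-closed Q z plus n j _ (all ∘ (false ∷_))) (Σ⊆-closed Q z plus n (dn j) _ (all ∘ (true ∷_)))

  data Span : Carrier → Set where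
    base : ∀ {n} (α : Vec ℤ n) → Dominant α → Span (S α)
    resp : ∀ {X Y} → X ≈ Y → Span X → Span Y
    plus : ∀ {X Y} → Span X → Span Y → Span (X + Y)
    neg  : ∀ {X} → Span X → Span (- X)

  span-1 : Span 1#
  span-1 = base [] tt

  span-0 : Span 0#
  span-0 = resp (-‿inverseʳ 1#) (plus span-1 (neg span-1))

  near-span : ∀ {n} (α : Vec ℤ n) → Near α → Span (S α)
  near-span α near with near-dichotomy α near
  ... | inj₁ dom = base α dom
  ... | inj₂ z = resp (sym z) span-0

  e-span : ∀ n {X} → Span X → Span (e n * X)
  -- The n appended zeros leave room for n new rows, as `pieri` demands.
  e-span n (base α dom) = resp (sym (trans (*-congˡ (sym (S-pad α n))) (pieri α n (+ n) ℤₚ.≤-refl)))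
    (Σ⊆-closed Span span-0 plus _ (+ n) _ (λ T → near-span _ (onSubset-up-near T _ (dominant-pad α n dom))))
  e-span n (resp eq s) = resp (*-congˡ eq) (e-span n s)
  e-span n (plus s t) = resp (sym (distribˡ _ _ _)) (plus (e-span n s) (e-span n t))
  e-span n (neg s) = resp (-‿distribʳ-* _ _) (neg (e-span n s))

  -- h_n is recovered from h_0,…,h_{n-1} and the e_k through h_d e_{k+1} = B_d e_{k+1} + B_{d+1} e_k.
  h-span : ∀ n m → m ℕ.< n → ∀ {X} → Span X → Span (h (+ m) * X)
  h-span (suc n) m (ℕ.s≤s m≤n) {X} s with ℕₚ.m≤n⇒m<n∨m≡n m≤n
  ... | inj₁ m<n = h-span n m m<n s
  ... | inj₂ ≡.refl = resp (*-congʳ (B-1 (+ m))) (hook m 0 (ℕₚ.+-identityʳ m))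
    where
    -- `B (+ d) (e k)` runs through the hooks of size m with decreasing arm. Each step splits off an
    -- `h (+ d)` with d < m, known from the outer induction; the run ends at B_0 1 = 1 or at B_0 B_1
    -- = 0.
    hook : ∀ d k → d ℕ.+ k ≡ m → Span (B (+ d) (e k) * X)
    hook zero zero eq = resp (sym (trans (*-congʳ B-0-1) (*-identityˡ X))) s
    hook zero (suc k) eq = resp (sym (trans (*-congʳ (B-0-e k)) (zeroˡ X))) span-0
    hook (suc d) k eq = resp (begin
        h (+ d) * (e (suc k) * X) - B (+ d) (e (suc k)) * X
          ≈⟨ -‿cong₂ refl (*-congʳ (B-e-suc (+ d) k)) ⟩
        h (+ d) * (e (suc k) * X) - (h (+ d) * e (suc k) - B (+ suc d) (e k)) * X
          ≈⟨ solve 4 (λ a b c x → a :* (b :* x) :- (a :* b :- c) :* x := c :* x) refl (h (+ d)) (e (suc k)) (B (+ suc d) (e k)) X ⟩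
        B (+ suc d) (e k) * X ∎)
      (plus (h-span m d (≡.subst (suc d ℕ.≤_) eq (ℕₚ.m≤m+n (suc d) k)) (e-span (suc k) s))
        (neg (hook d (suc k) (≡.trans (ℕₚ.+-suc d k) eq))))

  span-all : ∀ X → Span X
  span-all = ind Span resp plus neg span-1 mul
    where
    mul : ∀ a {X} → Span X → Span (h a * X)
    mul (+ n) = h-span (suc n) n ℕₚ.≤-refl
    mul -[1+ n ] s = resp (sym (trans (*-congʳ (h-neg n)) (zeroˡ _))) span-0

  schurL : List ℕ → Carrier
  schurL la = schurB (length la) (λ a → + List.lookup la a)

  -- Cuts off trailing zeros, since orthonormality is given for partitions with positive parts. The
  -- negative clause is a default value; dominant vectors never reach it.
  parts : ∀ {n} → Vec ℤ n → List ℕ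
  parts [] = []
  parts (+ zero ∷ cs) = []
  parts (+ suc m ∷ cs) = suc m ∷ parts cs
  parts (-[1+ _ ] ∷ cs) = []

  dominant-nonneg : ∀ {n} (α : Vec ℤ n) → Dominant α → 0ℤ ℤ.≤ head₀ α
  dominant-nonneg [] _ = ℤₚ.≤-refl
  dominant-nonneg (c ∷ cs) (p , dom) = ℤₚ.≤-trans (dominant-nonneg cs dom) p

  dominant-zeros : ∀ {n} (α : Vec ℤ n) → Dominant α → head₀ α ℤ.≤ 0ℤ → α ≡ replicate n 0ℤ
  dominant-zeros [] _ _ = ≡.refl
  dominant-zeros (c ∷ cs) (p , dom) q with ℤₚ.≤-antisym q (dominant-nonneg (c ∷ cs) (p , dom))
  ... | ≡.refl = ≡.cong (0ℤ ∷_) (dominant-zeros cs dom p)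

  schurL-parts : ∀ {n} (α : Vec ℤ n) → Dominant α → schurL (parts α) ≈ S α
  schurL-parts [] _ = refl
  schurL-parts {suc n} (+ zero ∷ cs) dom = sym (trans (reflexive (≡.cong S (dominant-zeros (0ℤ ∷ cs) dom ℤₚ.≤-refl))) (S-zeros (suc n)))
  schurL-parts (+ suc m ∷ cs) (p , dom) = B-cong (+ suc m) (schurL-parts cs dom)
  schurL-parts (-[1+ m ] ∷ cs) dom with dominant-nonneg (-[1+ m ] ∷ cs) dom
  ... | ()

  parts-injective : ∀ {n} (α β : Vec ℤ n) → Dominant α → Dominant β → parts α ≡ parts β → α ≡ β
  parts-injective [] [] _ _ _ = ≡.refl
  parts-injective (-[1+ m ] ∷ cs) _ dom _ _ with dominant-nonneg (-[1+ m ] ∷ cs) dom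
  ... | ()
  parts-injective (+ _ ∷ _) (-[1+ m ] ∷ cs) _ dom _ with dominant-nonneg (-[1+ m ] ∷ cs) dom
  ... | ()
  parts-injective (+ zero ∷ cs) (+ zero ∷ ds) a b eq =
    ≡.trans (dominant-zeros _ a ℤₚ.≤-refl) (≡.sym (dominant-zeros _ b ℤₚ.≤-refl))
  parts-injective (+ suc m ∷ cs) (+ suc m′ ∷ ds) (_ , a) (_ , b) eq with ∷-injective eq
  ... | ≡.refl , eq′ = ≡.cong (+ suc m ∷_) (parts-injective cs ds a b eq′)
  parts-injective (+ zero ∷ cs) (+ suc m ∷ ds) _ _ ()
  parts-injective (+ suc m ∷ cs) (+ zero ∷ ds) _ _ ()

  parts-partition : ∀ {n} (α : Vec ℤ n) → Dominant α → IsPartition (parts α)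
  parts-partition α dom = positive α , decreasing α dom
    where
    positive : ∀ {n} (α : Vec ℤ n) → All (λ x → 1 ℕ.≤ x) (parts α)
    positive [] = All.[]
    positive (+ zero ∷ cs) = All.[]
    positive (+ suc m ∷ cs) = ℕ.s≤s ℕ.z≤n All.∷ positive cs
    positive (-[1+ _ ] ∷ cs) = All.[]
    decreasing : ∀ {n} (α : Vec ℤ n) → Dominant α → Linked ℕ._≥_ (parts α)
    decreasing [] _ = Linked.[]
    decreasing (+ zero ∷ cs) _ = Linked.[]
    decreasing (-[1+ _ ] ∷ cs) _ = Linked.[]
    decreasing (+ suc m ∷ []) _ = [-]
    decreasing (+ suc m ∷ + zero ∷ cs) _ = [-]
    decreasing (+ suc m ∷ -[1+ _ ] ∷ cs) _ = [-]
    decreasing (+ suc m ∷ + suc m′ ∷ cs) (ℤ.+≤+ p , dom) = p Linked.∷ decreasing (+ suc m′ ∷ cs) dom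

  record IsHallForm (⟪_,_⟫ : Carrier → Carrier → ℤ) : Set where
    field
      ⟪⟫-resp : ∀ {X X′ Y Y′} → X ≈ X′ → Y ≈ Y′ → ⟪ X , Y ⟫ ≡ ⟪ X′ , Y′ ⟫
      ⟪⟫-addˡ : ∀ X X′ Y → ⟪ X + X′ , Y ⟫ ≡ ⟪ X , Y ⟫ ℤ.+ ⟪ X′ , Y ⟫
      ⟪⟫-addʳ : ∀ X Y Y′ → ⟪ X , Y + Y′ ⟫ ≡ ⟪ X , Y ⟫ ℤ.+ ⟪ X , Y′ ⟫
      ⟪⟫-orth : ∀ la mu → IsPartition la → IsPartition mu → ⟪ schurL la , schurL mu ⟫ ≡ δ la mu

  module Hall {⟪_,_⟫ : Carrier → Carrier → ℤ} (isHallForm : IsHallForm ⟪_,_⟫) where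
    open IsHallForm isHallForm

    additive-0 : (f : Carrier → ℤ) → (∀ {X Y} → X ≈ Y → f X ≡ f Y) → (∀ X Y → f (X + Y) ≡ f X ℤ.+ f Y) → f 0# ≡ 0ℤ
    additive-0 f f-cong f-+ = ∙-cancelˡ (f 0#) (f 0#) 0ℤ
      (≡.trans (≡.sym (f-+ 0# 0#)) (≡.trans (f-cong (+-identityʳ 0#)) (≡.sym (ℤₚ.+-identityʳ (f 0#)))))
      where open RingProperties (CommutativeRing.ring ℤₚ.+-*-commutativeRing) using () renaming (+-cancelˡ to ∙-cancelˡ)

    additive-neg : (f : Carrier → ℤ) → (∀ {X Y} → X ≈ Y → f X ≡ f Y) → (∀ X Y → f (X + Y) ≡ f X ℤ.+ f Y) → ∀ X → f (- X) ≡ ℤ.- f X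
    additive-neg f f-cong f-+ X = ∙-cancelˡ (f X) (f (- X)) (ℤ.- f X)
      (≡.trans (≡.sym (f-+ X (- X))) (≡.trans (f-cong (-‿inverseʳ X)) (≡.trans (additive-0 f f-cong f-+) (≡.sym (ℤₚ.+-inverseʳ (f X))))))
      where open RingProperties (CommutativeRing.ring ℤₚ.+-*-commutativeRing) using () renaming (+-cancelˡ to ∙-cancelˡ)

    ⟪⟫-0ˡ : ∀ Y → ⟪ 0# , Y ⟫ ≡ 0ℤ
    ⟪⟫-0ˡ Y = additive-0 (λ X → ⟪ X , Y ⟫) (λ eq → ⟪⟫-resp eq refl) (λ X X′ → ⟪⟫-addˡ X X′ Y)

    ⟪⟫-0ʳ : ∀ X → ⟪ X , 0# ⟫ ≡ 0ℤ
    ⟪⟫-0ʳ X = additive-0 (λ Y → ⟪ X , Y ⟫) (⟪⟫-resp refl) (⟪⟫-addʳ X)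

    ⟪⟫-negˡ : ∀ X Y → ⟪ - X , Y ⟫ ≡ ℤ.- ⟪ X , Y ⟫
    ⟪⟫-negˡ X Y = additive-neg (λ X → ⟪ X , Y ⟫) (λ eq → ⟪⟫-resp eq refl) (λ X X′ → ⟪⟫-addˡ X X′ Y) X

    ⟪⟫-negʳ : ∀ X Y → ⟪ X , - Y ⟫ ≡ ℤ.- ⟪ X , Y ⟫
    ⟪⟫-negʳ X = additive-neg (λ Y → ⟪ X , Y ⟫) (⟪⟫-resp refl) (⟪⟫-addʳ X)

    dominant-pairing : ∀ {n} (α β : Vec ℤ n) → Dominant α → Dominant β → ⟪ S α , S β ⟫ ≡ δ (parts α) (parts β)
    dominant-pairing α β a b = ≡.trans (⟪⟫-resp (sym (schurL-parts α a)) (sym (schurL-parts β b)))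
      (⟪⟫-orth (parts α) (parts β) (parts-partition α a) (parts-partition β b))

    dominant-norm : ∀ {n} (α : Vec ℤ n) → Dominant α → ⟪ S α , S α ⟫ ≡ 1ℤ
    dominant-norm α a = ≡.trans (dominant-pairing α α a a)
      (≡.cong (λ t → if t then 1ℤ else 0ℤ) (dec-true (≡-dec ℕ._≟_ (parts α) (parts α)) ≡.refl))

    dominant-orthogonal : ∀ {n} (α β : Vec ℤ n) → Dominant α → Dominant β → α ≢ β → ⟪ S α , S β ⟫ ≡ 0ℤ
    dominant-orthogonal α β a b α≢β = ≡.trans (dominant-pairing α β a b)
      (≡.cong (λ t → if t then 1ℤ else 0ℤ) (dec-false (≡-dec ℕ._≟_ (parts α) (parts β)) (α≢β ∘ parts-injective α β a b)))

    near-orthogonal : ∀ {n} (α β : Vec ℤ n) → Near α → Near β → α ≢ β → ⟪ S α , S β ⟫ ≡ 0ℤ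
    near-orthogonal α β a b α≢β with near-dichotomy α a | near-dichotomy β b
    ... | inj₁ a′ | inj₁ b′ = dominant-orthogonal α β a′ b′ α≢β
    ... | inj₂ z | _ = ≡.trans (⟪⟫-resp z refl) (⟪⟫-0ˡ (S β))
    ... | inj₁ _ | inj₂ z = ≡.trans (⟪⟫-resp refl z) (⟪⟫-0ʳ (S α))

    dominant⇒near : ∀ {n} (α : Vec ℤ n) → Dominant α → Near α
    dominant⇒near [] _ = tt
    dominant⇒near (c ∷ cs) (p , dom) = ℤₚ.≤-trans p (≤-up c) , dominant⇒near cs dom

    -- γ is μ raised on T exactly when μ is γ lowered on T, and then both pairings are 1. Otherwise
    -- both are 0, because all four vectors are `Near` and distinct `Near` vectors of equal length
    -- are orthogonal.
    subset-adjoint : ∀ {n} (γ μ : Vec ℤ n) → Dominant γ → Dominant μ → ∀ T →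
      ⟪ S γ , S (onSubset up T μ) ⟫ ≡ ⟪ S (onSubset dn T γ) , S μ ⟫
    subset-adjoint γ μ a b T with Vecₚ.≡-dec ℤ._≟_ γ (onSubset up T μ)
    ... | yes ≡.refl = ≡.trans (dominant-norm _ a) (≡.sym (≡.trans
        (≡.cong (λ ν → ⟪ S ν , S μ ⟫) (dn-onSubset-up T μ)) (dominant-norm μ b)))
    ... | no γ≢ = ≡.trans (near-orthogonal γ _ (dominant⇒near γ a) (onSubset-up-near T μ b) γ≢)
        (≡.sym (near-orthogonal _ μ (onSubset-dn-near T γ a) (dominant⇒near μ b)
          (λ eq → γ≢ (≡.trans (≡.sym (up-onSubset-dn T γ)) (≡.cong (onSubset up T) eq)))))

    Σ⊆-adjoint : ∀ n j X Y (φ ψ : Vec Bool n → Carrier) → (∀ T → ⟪ X , φ T ⟫ ≡ ⟪ ψ T , Y ⟫) → ⟪ X , Σ⊆ n j φ ⟫ ≡ ⟪ Σ⊆ n j ψ , Y ⟫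
    Σ⊆-adjoint zero (+ zero) X Y φ ψ eq = eq []
    Σ⊆-adjoint zero (+ suc _) X Y φ ψ eq = ≡.trans (⟪⟫-0ʳ X) (≡.sym (⟪⟫-0ˡ Y))
    Σ⊆-adjoint zero -[1+ _ ] X Y φ ψ eq = ≡.trans (⟪⟫-0ʳ X) (≡.sym (⟪⟫-0ˡ Y))
    Σ⊆-adjoint (suc n) j X Y φ ψ eq = ≡.trans (⟪⟫-addʳ X _ _) (≡.trans
      (≡.cong₂ ℤ._+_ (Σ⊆-adjoint n j X Y _ _ (eq ∘ (false ∷_))) (Σ⊆-adjoint n (dn j) X Y _ _ (eq ∘ (true ∷_))))
      (≡.sym (⟪⟫-addˡ _ _ Y)))

    Adjoint : ℕ → Carrier → Carrier → Set
    Adjoint d X Y = ⟪ X , e d * Y ⟫ ≡ ⟪ E (+ d) X , Y ⟫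

    adjoint-S : ∀ {N} d (γ μ : Vec ℤ N) → Dominant γ → Dominant μ → PieriAt (+ d) μ → Adjoint d (S γ) (S μ)
    adjoint-S {N} d γ μ a b pi = ≡.trans (⟪⟫-resp refl pi) (≡.trans
      (Σ⊆-adjoint N (+ d) (S γ) (S μ) _ _ (subset-adjoint γ μ a b)) (⟪⟫-resp (sym (E-S (+ d) γ)) refl))

    adjoint-resp : ∀ d {X X′ Y Y′} → X ≈ X′ → Y ≈ Y′ → Adjoint d X Y → Adjoint d X′ Y′
    adjoint-resp d p q eq = ≡.trans (⟪⟫-resp (sym p) (*-congˡ (sym q))) (≡.trans eq (⟪⟫-resp (E-cong (+ d) p) q))

    -- The subsets can be matched only for vectors of equal length, so both are padded to length m +
    -- n + d; the d additional zeros give `e d` its room.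
    adjoint-base : ∀ d {m n} (γ : Vec ℤ m) (μ : Vec ℤ n) → Dominant γ → Dominant μ → Adjoint d (S γ) (S μ)
    adjoint-base d {m} {n} γ μ a b with padded
      where
      padded : DominantAt (n ℕ.+ (d ℕ.+ m)) (S γ)
      padded = ≡.subst (λ N → DominantAt N (S γ))
        (≡.trans (≡.cong (m ℕ.+_) (ℕₚ.+-comm d n)) (≡.trans (ℕₚ.+-comm m (n ℕ.+ d)) (ℕₚ.+-assoc n d m)))
        (γ Vec.++ replicate (d ℕ.+ n) 0ℤ , dominant-pad γ (d ℕ.+ n) a , S-pad γ (d ℕ.+ n))
    ... | γ′ , a′ , eq = adjoint-resp d eq (S-pad μ (d ℕ.+ m))
      (adjoint-S d γ′ (μ Vec.++ replicate (d ℕ.+ m) 0ℤ) a′ (dominant-pad μ (d ℕ.+ m) b)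
        (pieri μ (d ℕ.+ m) (+ d) (ℤ.+≤+ (ℕₚ.m≤m+n d m))))

    adjoint-span : ∀ d {X Y} → Span X → Span Y → Adjoint d X Y
    adjoint-span d (base γ a) (base μ b) = adjoint-base d γ μ a b
    adjoint-span d s@(base _ _) (resp eq t) = adjoint-resp d refl eq (adjoint-span d s t)
    adjoint-span d {X} s@(base _ _) (plus {Y} {Y′} t t′) = ≡.trans (⟪⟫-resp refl (distribˡ (e d) Y Y′)) (≡.trans (⟪⟫-addʳ X _ _)
      (≡.trans (≡.cong₂ ℤ._+_ (adjoint-span d s t) (adjoint-span d s t′)) (≡.sym (⟪⟫-addʳ _ Y Y′))))
    adjoint-span d {X} s@(base _ _) (neg {Y} t) = ≡.trans (⟪⟫-resp refl (sym (-‿distribʳ-* (e d) Y))) (≡.trans (⟪⟫-negʳ X _)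
      (≡.trans (≡.cong ℤ.-_ (adjoint-span d s t)) (≡.sym (⟪⟫-negʳ _ Y))))
    adjoint-span d (resp eq s) t = adjoint-resp d eq refl (adjoint-span d s t)
    adjoint-span d {_} {Y} (plus {X} {X′} s s′) t = ≡.trans (⟪⟫-addˡ X X′ _)
      (≡.trans (≡.cong₂ ℤ._+_ (adjoint-span d s t) (adjoint-span d s′ t))
        (≡.trans (≡.sym (⟪⟫-addˡ _ _ Y)) (⟪⟫-resp (sym (E-+ (+ d) X X′)) refl)))
    adjoint-span d {_} {Y} (neg {X} s) t = ≡.trans (⟪⟫-negˡ X _) (≡.trans (≡.cong ℤ.-_ (adjoint-span d s t))
      (≡.trans (≡.sym (⟪⟫-negˡ _ Y)) (⟪⟫-resp (sym (P-neg (E-additive (+ d)) X)) refl)))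

    e-adjoint : ∀ d X Y → ⟪ X , e d * Y ⟫ ≡ ⟪ E (+ d) X , Y ⟫
    e-adjoint d X Y = adjoint-span d (span-all X) (span-all Y)

-- Λ as a commutative ring with operators

open Defs
open import Data.Bool using (T)
open import Data.Bool.Properties using (T?)
open import Data.Integer using (-_; _+_; _*_; _-_; ∣_∣)
open import Data.List using (_++_; map; applyUpTo; upTo; tabulate; filterᵇ; cartesianProduct)
open import Data.List.Properties using (++-assoc; ++-identityʳ; map-upTo; map-applyUpTo; map-tabulate)
open import Data.List.Relation.Binary.Permutation.Propositional using (_↭_; prep; swap) renaming (refl to ↭-refl; trans to ↭-trans)
open import Data.List.Relation.Binary.Permutation.Propositional.Properties using (++-comm; ++⁺ˡ)
import Data.List.Relation.Unary.All.Properties as Allₚ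
open import Data.Nat using (_∸_; _≤ᵇ_; _≡ᵇ_)
open import Data.Nat.Combinatorics using (_C_; nCn≡1; nCk≡nC[n∸k])
open ≡ using (refl; sym; trans; cong; cong₂; subst)

if-≤ : ∀ {A : Set} {x y} {a b : A} → x ℕ.≤ y → (if x ≤ᵇ y then a else b) ≡ a
if-≤ {x = x} {y} p with x ≤ᵇ y in eq
... | true  = refl
... | false = ⊥-elim (subst T eq (ℕₚ.≤⇒≤ᵇ p))

if-> : ∀ {A : Set} {x y} {a b : A} → y ℕ.< x → (if x ≤ᵇ y then a else b) ≡ b
if-> {x = x} {y} p with x ≤ᵇ y in eq
... | false = refl
... | true  = ⊥-elim (ℕₚ.<⇒≱ p (ℕₚ.≤ᵇ⇒≤ x y (subst T (sym eq) tt)))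

-- True for unsorted lists as well: the answers of x and y to each entry z never conflict. The case
-- x = y is split off because `if->` needs a strict inequality.
insert-comm-≤ : ∀ {x y} → x ℕ.≤ y → ∀ zs → insert x (insert y zs) ≡ insert y (insert x zs)
insert-comm-≤ {x} {y} x≤y zs with ℕₚ.m≤n⇒m<n∨m≡n x≤y
... | inj₂ refl = refl
... | inj₁ x<y = go zs
  where
  go : ∀ zs → insert x (insert y zs) ≡ insert y (insert x zs)
  go [] = trans (if-≤ x≤y) (sym (if-> x<y))
  go (z ∷ zs) with ℕₚ.≤-<-connex y z | ℕₚ.≤-<-connex x z
  ... | inj₁ y≤z | inj₁ x≤z =
    trans (cong (insert x) (if-≤ y≤z)) (trans (if-≤ x≤y)
      (sym (trans (cong (insert y) (if-≤ x≤z)) (trans (if-> x<y) (cong (x ∷_) (if-≤ y≤z))))))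
  ... | inj₁ y≤z | inj₂ z<x = ⊥-elim (ℕₚ.<⇒≱ z<x (ℕₚ.≤-trans x≤y y≤z))
  ... | inj₂ z<y | inj₁ x≤z =
    trans (cong (insert x) (if-> z<y)) (trans (if-≤ x≤z)
      (sym (trans (cong (insert y) (if-≤ x≤z)) (trans (if-> x<y) (cong (x ∷_) (if-> z<y))))))
  ... | inj₂ z<y | inj₂ z<x =
    trans (cong (insert x) (if-> z<y)) (trans (if-> z<x) (trans (cong (z ∷_) (go zs))
      (sym (trans (cong (insert y) (if-> z<x)) (if-> z<y)))))

insert-comm : ∀ x y zs → insert x (insert y zs) ≡ insert y (insert x zs)
insert-comm x y zs with ℕₚ.≤-total x y
... | inj₁ x≤y = insert-comm-≤ x≤y zs
... | inj₂ y≤x = sym (insert-comm-≤ y≤x zs)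

↭⇒sort≡ : ∀ {a b} → a ↭ b → sortℕ a ≡ sortℕ b
↭⇒sort≡ ↭-refl = refl
↭⇒sort≡ (prep x p) = cong (insert x) (↭⇒sort≡ p)
↭⇒sort≡ (swap {ys = ys} x y p) = trans (cong (insert x ∘ insert y) (↭⇒sort≡ p)) (insert-comm x y (sortℕ ys))
↭⇒sort≡ (↭-trans p q) = trans (↭⇒sort≡ p) (↭⇒sort≡ q)

-- Elements of Λ are compared through all linear functionals given by functions of the
-- monomials as multisets; the coefficients are among them.

lin : (Mon → ℤ) → Λ → ℤ
lin F [] = 0ℤ
lin F ((c , a) ∷ p) = c * F a + lin F p

Symmetric : (Mon → ℤ) → Set
Symmetric F = ∀ {a b} → a ↭ b → F a ≡ F b

χ : Mon → Mon → ℤ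
χ m a = if does (≡-dec ℕ._≟_ (sortℕ a) (sortℕ m)) then 1ℤ else 0ℤ

χ-sym : ∀ m → Symmetric (χ m)
χ-sym m p rewrite ↭⇒sort≡ p = refl

coeff≡lin : ∀ p m → coeff p m ≡ lin (χ m) p
coeff≡lin [] m = refl
coeff≡lin ((c , a) ∷ p) m with does (≡-dec ℕ._≟_ (sortℕ a) (sortℕ m))
... | true  = cong₂ _+_ (sym (ℤₚ.*-identityʳ c)) (coeff≡lin p m)
... | false = cong₂ _+_ (sym (ℤₚ.*-zeroʳ c)) (coeff≡lin p m)

lin-++ : ∀ F p q → lin F (p ++ q) ≡ lin F p + lin F q
lin-++ F [] q = sym (ℤₚ.+-identityˡ _)
lin-++ F ((c , a) ∷ p) q = trans (cong (_+_ (c * F a)) (lin-++ F p q)) (sym (ℤₚ.+-assoc (c * F a) _ _))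

lin-scale : ∀ F c p → lin F (scale c p) ≡ c * lin F p
lin-scale F c [] = sym (ℤₚ.*-zeroʳ c)
lin-scale F c ((d , a) ∷ p) = trans (cong₂ _+_ (ℤₚ.*-assoc c d (F a)) (lin-scale F c p)) (sym (ℤₚ.*-distribˡ-+ c _ _))

lin-cong : ∀ {F G} → (∀ a → F a ≡ G a) → ∀ p → lin F p ≡ lin G p
lin-cong eq [] = refl
lin-cong eq ((c , a) ∷ p) = cong₂ _+_ (cong (c *_) (eq a)) (lin-cong eq p)

lin-zero : ∀ p → lin (λ _ → 0ℤ) p ≡ 0ℤ
lin-zero [] = refl
lin-zero ((c , a) ∷ p) = cong₂ _+_ (ℤₚ.*-zeroʳ c) (lin-zero p)

lin-lin : ∀ F c G p → lin (λ a → c * F a + G a) p ≡ c * lin F p + lin G p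
lin-lin F c G [] = sym (trans (ℤₚ.+-identityʳ _) (ℤₚ.*-zeroʳ c))
lin-lin F c G ((d , a) ∷ p) = trans (cong (_+_ (d * (c * F a + G a))) (lin-lin F c G p))
  (solve 6 (λ d c f g x y → d :* (c :* f :+ g) :+ (c :* x :+ y) := c :* (d :* f :+ x) :+ (d :* g :+ y)) refl
    d c (F a) (G a) (lin F p) (lin G p))
  where open +-*-Solver

lin-swap : ∀ (G : Mon → Mon → ℤ) p q → lin (λ a → lin (G a) q) p ≡ lin (λ b → lin (λ a → G a b) p) q
lin-swap G [] q = sym (lin-zero q)
lin-swap G ((c , a) ∷ p) q = trans (cong (_+_ (c * lin (G a) q)) (lin-swap G p q))
  (sym (lin-lin (G a) c (λ b → lin (λ a → G a b) p) q))

lin-mono : ∀ F c a q → lin F (map (λ u → (c * proj₁ u , a ++ proj₂ u)) q) ≡ c * lin (λ b → F (a ++ b)) q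
lin-mono F c a [] = sym (ℤₚ.*-zeroʳ c)
lin-mono F c a ((d , b) ∷ q) = trans (cong₂ _+_ (ℤₚ.*-assoc c d _) (lin-mono F c a q)) (sym (ℤₚ.*-distribˡ-+ c _ _))

lin-* : ∀ F p q → lin F (p *Λ q) ≡ lin (λ a → lin (λ b → F (a ++ b)) q) p
lin-* F [] q = refl
lin-* F ((c , a) ∷ p) q = trans (lin-++ F (map _ q) (p *Λ q)) (cong₂ _+_ (lin-mono F c a q) (lin-* F p q))

infix 4 _≃_
-- Compatibility with products and operators is immediate for this relation: a symmetric functional
-- composed with multiplication by a monomial, or with a linearly extended operator, is again
-- symmetric. For coefficients alone this is not visible.
record _≃_ (p q : Λ) : Set where
  constructor mk≃
  field on : ∀ F → Symmetric F → lin F p ≡ lin F q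
open _≃_ public

≃⇒≈ : ∀ {p q} → p ≃ q → p ≈ q
≃⇒≈ {p} {q} eq m = trans (coeff≡lin p m) (trans (on eq (χ m) (χ-sym m)) (sym (coeff≡lin q m)))

lin-neg : ∀ F p → lin F (negΛ p) ≡ - lin F p
lin-neg F p = trans (lin-scale F (- 1ℤ) p) (ℤₚ.-1*i≡-i (lin F p))

≃-refl : ∀ {p} → p ≃ p
≃-refl = mk≃ λ _ _ → refl

≃-sym : ∀ {p q} → p ≃ q → q ≃ p
≃-sym eq = mk≃ λ F s → sym (on eq F s)

≃-trans : ∀ {p q r} → p ≃ q → q ≃ r → p ≃ r
≃-trans eq₁ eq₂ = mk≃ λ F s → trans (on eq₁ F s) (on eq₂ F s)

≃-reflexive : ∀ {p q} → p ≡ q → p ≃ q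
≃-reflexive refl = ≃-refl

+-cong : ∀ {p p′ q q′} → p ≃ p′ → q ≃ q′ → p +Λ q ≃ p′ +Λ q′
+-cong {p} {p′} {q} {q′} eq₁ eq₂ = mk≃ λ F s →
  trans (lin-++ F p q) (trans (cong₂ _+_ (on eq₁ F s) (on eq₂ F s)) (sym (lin-++ F p′ q′)))

+-comm : ∀ p q → p +Λ q ≃ q +Λ p
+-comm p q = mk≃ λ F _ → trans (lin-++ F p q) (trans (ℤₚ.+-comm (lin F p) (lin F q)) (sym (lin-++ F q p)))

scale-cong : ∀ c {p q} → p ≃ q → scale c p ≃ scale c q
scale-cong c {p} {q} eq = mk≃ λ F s → trans (lin-scale F c p) (trans (cong (c *_) (on eq F s)) (sym (lin-scale F c q)))

negΛ-inverseʳ : ∀ p → p +Λ negΛ p ≃ 0Λ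
negΛ-inverseʳ p = mk≃ λ F _ → trans (lin-++ F p (negΛ p)) (trans (cong (_+_ (lin F p)) (lin-neg F p)) (ℤₚ.+-inverseʳ (lin F p)))

*-comm : ∀ p q → p *Λ q ≃ q *Λ p
*-comm p q = mk≃ λ F F-sym → begin
  lin F (p *Λ q)                             ≡⟨ lin-* F p q ⟩
  lin (λ a → lin (λ b → F (a ++ b)) q) p     ≡⟨ lin-swap (λ a b → F (a ++ b)) p q ⟩
  lin (λ b → lin (λ a → F (a ++ b)) p) q     ≡⟨ lin-cong (λ b → lin-cong (λ a → F-sym (++-comm a b)) p) q ⟩
  lin (λ b → lin (λ a → F (b ++ a)) p) q     ≡⟨ lin-* F q p ⟨
  lin F (q *Λ p) ∎
  where open ≡-Reasoning

*-congˡ : ∀ p {q q′} → q ≃ q′ → p *Λ q ≃ p *Λ q′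
*-congˡ p {q} {q′} eq = mk≃ λ F F-sym → trans (lin-* F p q)
  (trans (lin-cong (λ a → on eq (λ b → F (a ++ b)) (λ r → F-sym (++⁺ˡ a r))) p) (sym (lin-* F p q′)))

*-cong : ∀ {p p′ q q′} → p ≃ p′ → q ≃ q′ → p *Λ q ≃ p′ *Λ q′
*-cong {p} {p′} {q} {q′} eq₁ eq₂ =
  ≃-trans (*-congˡ p eq₂) (≃-trans (*-comm p q′) (≃-trans (*-congˡ q′ eq₁) (*-comm q′ p′)))

*-assoc : ∀ p q r → (p *Λ q) *Λ r ≃ p *Λ (q *Λ r)
*-assoc p q r = mk≃ λ F F-sym → begin
  lin F ((p *Λ q) *Λ r)                                             ≡⟨ lin-* F (p *Λ q) r ⟩
  lin (λ ab → lin (λ c → F (ab ++ c)) r) (p *Λ q)                    ≡⟨ lin-* _ p q ⟩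
  lin (λ a → lin (λ b → lin (λ c → F ((a ++ b) ++ c)) r) q) p        ≡⟨ lin-cong (λ a → lin-cong (λ b → lin-cong (λ c → cong F (++-assoc a b c)) r) q) p ⟩
  lin (λ a → lin (λ b → lin (λ c → F (a ++ (b ++ c))) r) q) p        ≡⟨ lin-cong (λ a → lin-* (λ bc → F (a ++ bc)) q r) p ⟨
  lin (λ a → lin (λ bc → F (a ++ bc)) (q *Λ r)) p                    ≡⟨ lin-* F p (q *Λ r) ⟨
  lin F (p *Λ (q *Λ r)) ∎
  where open ≡-Reasoning

*-distribʳ : ∀ p q r → (q +Λ r) *Λ p ≃ q *Λ p +Λ r *Λ p
*-distribʳ p q r = mk≃ λ F _ → trans (lin-* F (q ++ r) p) (trans (lin-++ _ q r)
  (sym (trans (lin-++ F (q *Λ p) (r *Λ p)) (cong₂ _+_ (lin-* F q p) (lin-* F r p)))))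

*-identityˡ : ∀ p → 1Λ *Λ p ≃ p
*-identityˡ p = mk≃ λ F _ → trans (lin-* F 1Λ p) (trans (ℤₚ.+-identityʳ _) (ℤₚ.*-identityˡ (lin F p)))

Λ-ring : CommutativeRing _ _
Λ-ring = record
  { Carrier = Λ ; _≈_ = _≃_ ; _+_ = _+Λ_ ; _*_ = _*Λ_ ; -_ = negΛ ; 0# = 0Λ ; 1# = 1Λ
  ; isCommutativeRing = record
    { isRing = record
      { +-isAbelianGroup = record
        { isGroup = record
          { isMonoid = record
            { isSemigroup = record
              { isMagma = record
                { isEquivalence = record { refl = ≃-refl ; sym = ≃-sym ; trans = ≃-trans }
                ; ∙-cong = +-cong }
              ; assoc = λ p q r → ≃-reflexive (++-assoc p q r) }
            ; identity = (λ _ → ≃-refl) , (λ p → ≃-reflexive (++-identityʳ p)) }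
          ; inverse = (λ p → ≃-trans (+-comm (negΛ p) p) (negΛ-inverseʳ p)) , negΛ-inverseʳ
          ; ⁻¹-cong = scale-cong (- 1ℤ) }
        ; comm = +-comm }
      ; *-cong = *-cong
      ; *-assoc = *-assoc
      ; *-identity = *-identityˡ , (λ p → ≃-trans (*-comm p 1Λ) (*-identityˡ p))
      ; distrib = (λ p q r → ≃-trans (*-comm p (q +Λ r)) (≃-trans (*-distribʳ p q r) (+-cong (*-comm q p) (*-comm r p)))) , *-distribʳ }
    ; *-comm = *-comm } }

lin-plus : ∀ F G p → lin (λ a → F a + G a) p ≡ lin F p + lin G p
lin-plus F G p = trans (lin-cong (λ a → cong (_+ G a) (sym (ℤₚ.*-identityˡ (F a)))) p)
  (trans (lin-lin F 1ℤ G p) (cong (_+ lin G p) (ℤₚ.*-identityˡ (lin F p))))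

extend : (Mon → Λ) → Λ → Λ
extend F [] = []
extend F ((c , a) ∷ p) = scale c (F a) ++ extend F p

lin-extend : ∀ G F p → lin G (extend F p) ≡ lin (λ a → lin G (F a)) p
lin-extend G F [] = refl
lin-extend G F ((c , a) ∷ p) = trans (lin-++ G (scale c (F a)) (extend F p)) (cong₂ _+_ (lin-scale G c (F a)) (lin-extend G F p))

extend-cong : ∀ F → (∀ {a b} → a ↭ b → F a ≃ F b) → ∀ {p q} → p ≃ q → extend F p ≃ extend F q
extend-cong F F-sym {p} {q} eq = mk≃ λ G G-sym →
  trans (lin-extend G F p) (trans (on eq _ λ r → on (F-sym r) G G-sym) (sym (lin-extend G F q)))

extend-+ : ∀ F p q → extend F (p +Λ q) ≃ extend F p +Λ extend F q
extend-+ F p q = mk≃ λ G _ → trans (lin-extend G F (p ++ q)) (trans (lin-++ _ p q)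
  (sym (trans (lin-++ G (extend F p) (extend F q)) (cong₂ _+_ (lin-extend G F p) (lin-extend G F q)))))

lin-*-extend : ∀ G Z F p → lin G (Z *Λ extend F p) ≡ lin (λ a → lin G (Z *Λ F a)) p
lin-*-extend G Z F p = begin
  lin G (Z *Λ extend F p)                                        ≡⟨ lin-* G Z (extend F p) ⟩
  lin (λ a → lin (λ b → G (a ++ b)) (extend F p)) Z              ≡⟨ lin-cong (λ a → lin-extend (λ b → G (a ++ b)) F p) Z ⟩
  lin (λ a → lin (λ c → lin (λ b → G (a ++ b)) (F c)) p) Z    ≡⟨ lin-swap _ Z p ⟩
  lin (λ c → lin (λ a → lin (λ b → G (a ++ b)) (F c)) Z) p    ≡⟨ lin-cong (λ c → lin-* G Z (F c)) p ⟨
  lin (λ c → lin G (Z *Λ F c)) p ∎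
  where open ≡-Reasoning

lin-h : ∀ G n X → lin G (h (suc n) *Λ X) ≡ lin (λ b → G (n ∷ b)) X
lin-h G n X = trans (lin-* G (h (suc n)) X) (trans (ℤₚ.+-identityʳ _) (ℤₚ.*-identityˡ _))

Λ-const : ℤ-rawRing -Raw-AlmostCommutative⟶ fromCommutativeRing Λ-ring
Λ-const = record
  { ⟦_⟧ = λ c → (c , []) ∷ []
  ; +-homo = λ a b → mk≃ λ F _ → solve 3 (λ a b f → (a :+ b) :* f :+ con 0ℤ := a :* f :+ (b :* f :+ con 0ℤ)) refl a b (F [])
  ; *-homo = λ a b → ≃-refl
  ; -‿homo = λ a → mk≃ λ F _ → solve 2 (λ a f → :- a :* f :+ con 0ℤ := con (- 1ℤ) :* a :* f :+ con 0ℤ) refl a (F [])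
  ; 0-homo = mk≃ λ F _ → refl
  ; 1-homo = ≃-refl
  }
  where open +-*-Solver

-- One recursion yields both families: op_i 1 = `u i` and op_i (h_a X) = h_a op_i X + κ h_{a-1}
-- op_{next i} X. With `dn`, 1 and `δ₀` this is e_i^⊥; with `up`, -1 and `hℤ` it is B_i.
module Operator (next : ℤ → ℤ) (κ : Λ) (u : ℤ → Λ) where

  open CommutativeRing Λ-ring using (zeroʳ; setoid) renaming (+-identityʳ to +-idʳ)

  opMon : ℤ → Mon → Λ
  opMon i [] = u i
  opMon i (n ∷ a) = h (suc n) *Λ opMon i a +Λ κ *Λ (h n *Λ opMon (next i) a)

  opMon-∷ : ∀ x a b → (∀ i → opMon i a ≃ opMon i b) → ∀ i → opMon i (x ∷ a) ≃ opMon i (x ∷ b)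
  opMon-∷ x a b eq i = +-cong {h (suc x) *Λ opMon i a} (*-congˡ (h (suc x)) (eq i)) (*-congˡ κ (*-congˡ (h x) (eq (next i))))

  -- Two factors expand to xy p + κ (xy′ + x′y) q + κ² x′y′ r, which is symmetric in them; so
  -- recursion along the list depends only on the multiset.
  opMon-↭ : ∀ {a b} → a ↭ b → ∀ i → opMon i a ≃ opMon i b
  opMon-↭ ↭-refl i = ≃-refl
  opMon-↭ (prep {a} {b} x p) i = opMon-∷ x a b (opMon-↭ p) i
  opMon-↭ (swap {a} {b} x y p) i = ≃-trans
    (opMon-↭-swap (h (suc x)) (h x) (h (suc y)) (h y) κ (opMon i a) (opMon (next i) a) (opMon (next (next i)) a))
    (opMon-∷ y (x ∷ a) (x ∷ b) (opMon-∷ x a b (opMon-↭ p)) i)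
    where
    opMon-↭-swap : ∀ x x′ y y′ κ p q r →
      x *Λ (y *Λ p +Λ κ *Λ (y′ *Λ q)) +Λ κ *Λ (x′ *Λ (y *Λ q +Λ κ *Λ (y′ *Λ r))) ≃
      y *Λ (x *Λ p +Λ κ *Λ (x′ *Λ q)) +Λ κ *Λ (y′ *Λ (x *Λ q +Λ κ *Λ (x′ *Λ r)))
    opMon-↭-swap = solve 8 (λ x x′ y y′ κ p q r →
      x :* (y :* p :+ κ :* (y′ :* q)) :+ κ :* (x′ :* (y :* q :+ κ :* (y′ :* r))) :=
      y :* (x :* p :+ κ :* (x′ :* q)) :+ κ :* (y′ :* (x :* q :+ κ :* (x′ :* r)))) ≃-refl
      where open RingSolver Λ-ring Λ-const
  opMon-↭ (↭-trans p q) i = ≃-trans (opMon-↭ p i) (opMon-↭ q i)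

  op : ℤ → Λ → Λ
  op i = extend (opMon i)

  op-cong : ∀ i {X Y} → X ≃ Y → op i X ≃ op i Y
  op-cong i = extend-cong (opMon i) (λ p → opMon-↭ p i)

  op-+ : ∀ i X Y → op i (X +Λ Y) ≃ op i X +Λ op i Y
  op-+ i = extend-+ (opMon i)

  op-1 : ∀ i → op i 1Λ ≃ u i
  op-1 i = mk≃ λ F _ → trans (lin-++ F (scale 1ℤ (u i)) []) (trans (ℤₚ.+-identityʳ _) (trans (lin-scale F 1ℤ (u i)) (ℤₚ.*-identityˡ _)))

  op-h : ∀ i a X → op i (hℤ a *Λ X) ≃ hℤ a *Λ op i X +Λ κ *Λ (hℤ (dn a) *Λ op (next i) X)
  op-h i (+ zero) X = begin
    op i (1Λ *Λ X)                                      ≈⟨ op-cong i (*-identityˡ X) ⟩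
    op i X                                              ≈⟨ *-identityˡ (op i X) ⟨
    1Λ *Λ op i X                                        ≈⟨ +-idʳ (1Λ *Λ op i X) ⟨
    1Λ *Λ op i X +Λ 0Λ                                  ≈⟨ +-cong (≃-refl {1Λ *Λ op i X}) (zeroʳ κ) ⟨
    1Λ *Λ op i X +Λ κ *Λ (0Λ *Λ op (next i) X)          ∎
    where open import Relation.Binary.Reasoning.Setoid setoid
  op-h i -[1+ n ] X = ≃-sym (zeroʳ κ)
  op-h i (+ suc n) X = mk≃ λ G _ → begin
    lin G (op i (h (suc n) *Λ X))                             ≡⟨ lin-extend G (opMon i) (h (suc n) *Λ X) ⟩
    lin (λ a → lin G (opMon i a)) (h (suc n) *Λ X)            ≡⟨ lin-h (λ a → lin G (opMon i a)) n X ⟩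
    lin (λ a → lin G (opMon i (n ∷ a))) X                     ≡⟨ lin-cong (λ a → lin-++ G (h (suc n) *Λ opMon i a) _) X ⟩
    lin (λ a → lin G (h (suc n) *Λ opMon i a) + lin G (κ *Λ (h n *Λ opMon (next i) a))) X  ≡⟨ lin-plus _ _ X ⟩
    lin (λ a → lin G (h (suc n) *Λ opMon i a)) X + lin (λ a → lin G (κ *Λ (h n *Λ opMon (next i) a))) X
      ≡⟨ cong₂ _+_ (sym (lin-*-extend G (h (suc n)) (opMon i) X)) (sym (trans (lin-* G κ _)
           (trans (lin-cong (λ b → lin-*-extend (λ c → G (b ++ c)) (h n) (opMon (next i)) X) κ) (trans (lin-swap _ κ X) (lin-cong (λ a → sym (lin-* G κ _)) X))))) ⟩
    lin G (h (suc n) *Λ op i X) + lin G (κ *Λ (h n *Λ op (next i) X))   ≡⟨ lin-++ G (h (suc n) *Λ op i X) _ ⟨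
    lin G (h (suc n) *Λ op i X +Λ κ *Λ (h n *Λ op (next i) X)) ∎
    where open ≡-Reasoning

-- Closure under integer multiples is not among the premises, so coefficients are built up by
-- repeated addition and negation.
Λ-ind : (Q : Λ → Set) → (∀ {X Y} → X ≃ Y → Q X → Q Y) → (∀ {X Y} → Q X → Q Y → Q (X +Λ Y)) → (∀ {X} → Q X → Q (negΛ X)) →
        Q 1Λ → (∀ a {X} → Q X → Q (hℤ a *Λ X)) → ∀ X → Q X
Λ-ind Q resp plus neg one mul = go
  where
  nil : Q []
  nil = resp (negΛ-inverseʳ 1Λ) (plus one (neg one))
  mono : ∀ a → Q ((1ℤ , a) ∷ [])
  mono [] = one
  mono (n ∷ a) = mul (+ suc n) (mono a)
  pos : ∀ n a → Q ((+ n , a) ∷ [])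
  pos zero a = resp (mk≃ λ _ _ → refl) nil
  pos (suc n) a = resp (mk≃ λ F _ → solve 2 (λ n f → con 1ℤ :* f :+ (n :* f :+ con 0ℤ) := (con 1ℤ :+ n) :* f :+ con 0ℤ) refl (+ n) (F a))
    (plus (mono a) (pos n a))
    where open +-*-Solver
  single : ∀ c a → Q ((c , a) ∷ [])
  single (+ n) a = pos n a
  single -[1+ n ] a = resp (mk≃ λ F _ → cong (λ z → z * F a + 0ℤ) (ℤₚ.-1*i≡-i (+ suc n))) (neg (pos (suc n) a))
  go : ∀ X → Q X
  go [] = nil
  go ((c , a) ∷ X) = plus (single c a) (go X)

δ₀ : ℤ → Λ
δ₀ (+ zero) = 1Λ
δ₀ _ = 0Λ

module Skew = Operator dn 1Λ δ₀
module Bern = Operator up (negΛ 1Λ) hℤ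

module ΛR = CommutativeRing Λ-ring

Λ-bernstein : BernsteinAlgebra
Λ-bernstein = record
  { commRing = Λ-ring
  ; const = Λ-const
  ; h = hℤ
  ; h-zero = ≃-refl
  ; h-neg = λ _ → ≃-refl
  ; E = Skew.op
  ; B = Bern.op
  ; E-cong = Skew.op-cong
  ; E-+ = Skew.op-+
  ; E-1 = Skew.op-1 0ℤ
  ; E-1-suc = λ n → Skew.op-1 (+ suc n)
  ; E-1-neg = λ n → Skew.op-1 -[1+ n ]
  ; E-h = λ i a X → ≃-trans (Skew.op-h i a X) (+-cong {hℤ a *Λ Skew.op i X} ≃-refl (*-identityˡ _))
  ; B-cong = Bern.op-cong
  ; B-+ = Bern.op-+
  ; B-1 = Bern.op-1
  ; B-h = λ d a X → ≃-trans (Bern.op-h d a X) (+-cong {hℤ a *Λ Bern.op d X} ≃-refl (-1*x≈-x _))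
  ; ind = Λ-ind
  }
  where open RingProperties ΛR.ring using (-1*x≈-x)

module Λ-Theory = Theory Λ-bernstein
module Λ-Det = Determinants Λ-bernstein
module Λ-Pieri = Pieri Λ-bernstein
open Λ-Theory using (Additive; E-additive; alt; alt-cong; id-additive)
open Additive

-- Translation of the given determinants, Schur functions and form

E : ℤ → Λ → Λ
E = Skew.op

scale-1 : ∀ p → scale 1ℤ p ≃ p
scale-1 p = mk≃ λ F _ → trans (lin-scale F 1ℤ p) (ℤₚ.*-identityˡ _)

scale-neg : ∀ c p → scale (- c) p ≃ negΛ (scale c p)
scale-neg c p = mk≃ λ F _ → trans (lin-scale F (- c) p) (sym (trans (lin-neg F (scale c p))
  (trans (cong -_ (lin-scale F c p)) (ℤₚ.neg-distribˡ-* c (lin F p)))))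

scale-additive : ∀ c → Additive (scale c)
scale-additive c = record
  { P-cong = scale-cong c
  ; P-+ = λ p q → mk≃ λ F _ → trans (lin-scale F c (p ++ q)) (trans (cong (c *_) (lin-++ F p q))
      (trans (ℤₚ.*-distribˡ-+ c _ _) (sym (trans (lin-++ F (scale c p) (scale c q)) (cong₂ _+_ (lin-scale F c p) (lin-scale F c q)))))) }

scale-* : ∀ c p q → scale c p *Λ q ≃ scale c (p *Λ q)
scale-* c p q = mk≃ λ F _ → trans (lin-* F (scale c p) q) (trans (lin-scale _ c p)
  (sym (trans (lin-scale F c (p *Λ q)) (cong (c *_) (lin-* F p q)))))

E-scale : ∀ i c p → E i (scale c p) ≃ scale c (E i p)
E-scale i c p = mk≃ λ G _ → trans (lin-extend G (Skew.opMon i) (scale c p)) (trans (lin-scale _ c p)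
  (sym (trans (lin-scale G c (E i p)) (cong (c *_) (lin-extend G (Skew.opMon i) p)))))

sumΛ-additive : ∀ {P} → Additive P → ∀ {A : Set} (f : A → Λ) xs → P (sumΛ (map f xs)) ≃ sumΛ (map (P ∘ f) xs)
sumΛ-additive p f [] = P-0 p
sumΛ-additive p f (x ∷ xs) = ≃-trans (P-+ p (f x) (sumΛ (map f xs))) (ΛR.+-congˡ (sumΛ-additive p f xs))

sumΛ-cong : ∀ {A : Set} {f g : A → Λ} {xs} → All (λ x → f x ≃ g x) xs → sumΛ (map f xs) ≃ sumΛ (map g xs)
sumΛ-cong [] = ≃-refl
sumΛ-cong (eq ∷ eqs) = +-cong eq (sumΛ-cong eqs)

sumΛ-0 : ∀ {A : Set} {f : A → Λ} {xs} → All (λ x → f x ≃ 0Λ) xs → sumΛ (map f xs) ≃ 0Λ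
sumΛ-0 [] = ≃-refl
sumΛ-0 (eq ∷ eqs) = +-cong eq (sumΛ-0 eqs)

sumΛ-sign : ∀ n (F : Fin n → Λ) → sumΛ (map (λ j → scale (sign (toℕ j)) (F j)) (List.allFin n)) ≃ alt n F
sumΛ-sign n F = ≃-trans (≃-reflexive (cong sumΛ (map-tabulate id (λ j → scale (sign (toℕ j)) (F j))))) (go n F)
  where
  neg-sum : ∀ n (c : Fin n → ℤ) (F : Fin n → Λ) → sumΛ (tabulate (λ j → scale (- c j) (F j))) ≃ negΛ (sumΛ (tabulate (λ j → scale (c j) (F j))))
  neg-sum zero c F = ≃-refl
  neg-sum (suc n) c F = ≃-trans (+-cong (scale-neg (c Fin.zero) (F Fin.zero)) (neg-sum n (c ∘ Fin.suc) (F ∘ Fin.suc)))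
    (≃-sym (P-+ (scale-additive (- 1ℤ)) (scale (c Fin.zero) (F Fin.zero)) _))
  go : ∀ n (F : Fin n → Λ) → sumΛ (tabulate (λ j → scale (sign (toℕ j)) (F j))) ≃ alt n F
  go zero F = ≃-refl
  go (suc n) F = +-cong (scale-1 (F Fin.zero))
    (≃-trans (neg-sum n (λ j → sign (toℕ j)) (F ∘ Fin.suc)) (scale-cong (- 1ℤ) (go n (F ∘ Fin.suc))))

det≃ : ∀ n M → det n M ≃ Λ-Det.det n M
det≃ zero M = ≃-refl
det≃ (suc n) M = ≃-trans (sumΛ-sign (suc n) (λ j → M Fin.zero j *Λ det n (λ a b → M (Fin.suc a) (punchIn j b))))
  (alt-cong (suc n) (λ j → *-congˡ (M Fin.zero j) (det≃ n (λ a b → M (Fin.suc a) (punchIn j b)))))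

schur≃ : ∀ la → schur la ≃ Λ-Pieri.schurL la
schur≃ la = ≃-trans (det≃ (List.length la) _) (Λ-Det.jacobiTrudi (List.length la) (λ a → + List.lookup la a))

e≃ : ∀ d → e d ≃ Λ-Theory.e d
e≃ d = ≃-trans (det≃ d _) (≃-trans (Λ-Det.jacobiTrudi d (λ _ → 1ℤ)) (column d))
  where
  column : ∀ d → Λ-Det.schurB d (λ _ → 1ℤ) ≃ Λ-Theory.e d
  column zero = ≃-refl
  column (suc d) = Bern.op-cong 1ℤ (column d)

isHallForm : ∀ {B} → IsHall B → Λ-Pieri.IsHallForm B
isHallForm hall = record
  { ⟪⟫-resp = λ p q → IsHall.resp hall (≃⇒≈ p) (≃⇒≈ q)
  ; ⟪⟫-addˡ = IsHall.addˡ hall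
  ; ⟪⟫-addʳ = IsHall.addʳ hall
  ; ⟪⟫-orth = λ la mu p q → trans (IsHall.resp hall (≃⇒≈ (≃-sym (schur≃ la))) (≃⇒≈ (≃-sym (schur≃ mu)))) (IsHall.orth hall la mu p q)
  }

e⊥-adjoint : ∀ {B} → IsHall B → ∀ d X x → B X (e d *Λ x) ≡ B (E (+ d) X) x
e⊥-adjoint hall d X x = trans (IsHallForm.⟪⟫-resp (isHallForm hall) {X} ≃-refl (ΛR.*-congʳ (e≃ d)))
  (Λ-Pieri.Hall.e-adjoint (isHallForm hall) d X x)
  where open Λ-Pieri using (module IsHallForm)

-- P′ is P with every index of h lowered by one.
ShiftPair : Λ → Λ → Set
ShiftPair P P′ = ∀ i X → E i (P *Λ X) ≃ P *Λ E i X +Λ P′ *Λ E (dn i) X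

shiftPair-0 : ShiftPair 0Λ 0Λ
shiftPair-0 i X = ≃-refl

shiftPair-+ : ∀ {P P′ Q Q′} → ShiftPair P P′ → ShiftPair Q Q′ → ShiftPair (P +Λ Q) (P′ +Λ Q′)
shiftPair-+ {P} {P′} {Q} {Q′} p q i X = begin
  E i ((P +Λ Q) *Λ X)                                   ≈⟨ Skew.op-cong i (*-distribʳ X P Q) ⟩
  E i (P *Λ X +Λ Q *Λ X)                                ≈⟨ Skew.op-+ i (P *Λ X) (Q *Λ X) ⟩
  E i (P *Λ X) +Λ E i (Q *Λ X)                          ≈⟨ +-cong (p i X) (q i X) ⟩
  (P *Λ E i X +Λ P′ *Λ E (dn i) X) +Λ (Q *Λ E i X +Λ Q′ *Λ E (dn i) X)  ≈⟨ solve 6 (λ p p′ q q′ x y →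
      (p :* x :+ p′ :* y) :+ (q :* x :+ q′ :* y) := (p :+ q) :* x :+ (p′ :+ q′) :* y) ≃-refl P P′ Q Q′ (E i X) (E (dn i) X) ⟩
  (P +Λ Q) *Λ E i X +Λ (P′ +Λ Q′) *Λ E (dn i) X ∎
  where
  open import Relation.Binary.Reasoning.Setoid ΛR.setoid
  open RingSolver Λ-ring Λ-const

shiftPair-h : ∀ c a → ShiftPair (scale c (hℤ a)) (scale c (hℤ (dn a)))
shiftPair-h c a i X = begin
  E i (scale c (hℤ a) *Λ X)                                   ≈⟨ Skew.op-cong i (scale-* c (hℤ a) X) ⟩
  E i (scale c (hℤ a *Λ X))                                   ≈⟨ E-scale i c (hℤ a *Λ X) ⟩
  scale c (E i (hℤ a *Λ X))                                   ≈⟨ scale-cong c (BernsteinAlgebra.E-h Λ-bernstein i a X) ⟩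
  scale c (hℤ a *Λ E i X +Λ hℤ (dn a) *Λ E (dn i) X)          ≈⟨ P-+ (scale-additive c) (hℤ a *Λ E i X) _ ⟩
  scale c (hℤ a *Λ E i X) +Λ scale c (hℤ (dn a) *Λ E (dn i) X)  ≈⟨ +-cong (scale-* c (hℤ a) (E i X)) (scale-* c (hℤ (dn a)) (E (dn i) X)) ⟨
  scale c (hℤ a) *Λ E i X +Λ scale c (hℤ (dn a)) *Λ E (dn i) X ∎
  where open import Relation.Binary.Reasoning.Setoid ΛR.setoid

-- The coefficients form an arbitrary sequence, so that dropping the first term leaves
-- `hSum (b ∘ suc)` and induction on m applies.
hSum : (ℕ → ℤ) → ℕ → Λ
hSum b m = sumΛ (applyUpTo (λ i → scale (b i) (h (m ∸ i))) (suc m))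

hSum⁻ : (ℕ → ℤ) → ℕ → Λ
hSum⁻ b zero = 0Λ
hSum⁻ b (suc m) = hSum b m

-- A coefficient depends on the position i and not on m, and the last term b_m h_0 lowers to zero.
-- Lowering all indices therefore gives the sum for m - 1 with the same b; this is why k^{(r)}_m
-- lowers to k^{(r)}_{m-1}.
shiftPair-hSum : ∀ b m → ShiftPair (hSum b m) (hSum⁻ b m)
shiftPair-hSum b zero = shiftPair-+ {scale (b 0) 1Λ} {0Λ} {0Λ} {0Λ} (shiftPair-h (b 0) 0ℤ) shiftPair-0
shiftPair-hSum b (suc zero) = shiftPair-+ {scale (b 0) (h 1)} {scale (b 0) (h 0)} {hSum (b ∘ suc) 0} {0Λ}
  (shiftPair-h (b 0) (+ 1)) (shiftPair-hSum (b ∘ suc) 0)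
shiftPair-hSum b (suc (suc m)) = shiftPair-+ {scale (b 0) (h (suc (suc m)))} {scale (b 0) (h (suc m))} {hSum (b ∘ suc) (suc m)} {hSum (b ∘ suc) m}
  (shiftPair-h (b 0) (+ suc (suc m))) (shiftPair-hSum (b ∘ suc) (suc m))

kCoef : ℤ → ℕ → ℤ
kCoef r i = binomℤ (r + + i - 1ℤ) i

kk≡hSum : ∀ r m → kk r (+ m) ≡ hSum (kCoef r) m
kk≡hSum r m = cong sumΛ (map-upTo (λ i → scale (kCoef r i) (h (m ∸ i))) (suc m))

kk-shift : ∀ r z → ShiftPair (kk r z) (kk r (dn z))
kk-shift r (+ zero) = subst (λ K → ShiftPair K 0Λ) (sym (kk≡hSum r 0)) (shiftPair-hSum (kCoef r) 0)
kk-shift r (+ suc m) = ≡.subst₂ ShiftPair (sym (kk≡hSum r (suc m))) (sym (kk≡hSum r m)) (shiftPair-hSum (kCoef r) (suc m))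
kk-shift r -[1+ n ] = shiftPair-0

-- Action of e_j^⊥ on g_γ and on the expansions

module _ (ℓ : ℕ) where

  kRow : (ℕ → ℤ) → Fin ℓ → ℤ → Λ
  kRow γ a z = kk (+ toℕ a) (γ (suc (toℕ a)) - + toℕ a + z)

  kRow-shiftLinear : ∀ γ a → Λ-Det.ShiftLinear (kRow γ a)
  kRow-shiftLinear γ a i c X = subst (λ z → E i (kRow γ a c *Λ X) ≃ kRow γ a c *Λ E i X +Λ kk (+ toℕ a) z *Λ E (dn i) X)
    (sym (+-dn (γ (suc (toℕ a)) - + toℕ a) c)) (kk-shift (+ toℕ a) (γ (suc (toℕ a)) - + toℕ a + c) i X)

  gγ≃ : ∀ γ → gγ ℓ γ ≃ Λ-Det.colDet ℓ (kRow γ) (λ b → + toℕ b)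
  gγ≃ γ = ≃-trans (det≃ ℓ _) (Λ-Det.det-cong ℓ λ a b → ≃-reflexive (cong (kk (+ toℕ a)) (index (γ (suc (toℕ a))) (+ toℕ a) (+ toℕ b))))
    where
    open +-*-Solver
    index : ∀ g a b → g + b - a ≡ g - a + b
    index = solve 3 (λ g a b → g :+ b :- a := g :- a :+ b) refl

  E-gγ-large : ∀ m γ → E (+ suc (ℓ ℕ.+ m)) (gγ ℓ γ) ≃ 0Λ
  E-gγ-large m γ = ≃-trans (Skew.op-cong (+ suc (ℓ ℕ.+ m)) (gγ≃ γ)) (Λ-Det.E-colDet-large ℓ (kRow γ) (kRow-shiftLinear γ) _ m)

  -- Compared only at the positions 1,...,ℓ that `gγ` reads: beyond ℓ, `at` is 0 for λ and for λ+1^ℓ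
  -- alike.
  OneAbove : (γ γ′ : ℕ → ℤ) → Set
  OneAbove γ γ′ = ∀ (a : Fin ℓ) → γ (suc (toℕ a)) ≡ γ′ (suc (toℕ a)) + 1ℤ

  -- e_ℓ^⊥ lowers all ℓ columns. An entry of row a depends on γ_a and the column label through their
  -- sum, so this equals lowering every γ_a.
  E-gγ : ∀ {γ γ′} → OneAbove γ γ′ → E (+ ℓ) (gγ ℓ γ) ≃ gγ ℓ γ′
  E-gγ {γ} {γ′} above = ≃-trans (Skew.op-cong (+ ℓ) (gγ≃ γ)) (≃-trans (Λ-Det.E-colDet-full ℓ (kRow γ) (kRow-shiftLinear γ) (λ b → + toℕ b))
    (≃-trans (Λ-Det.det-cong ℓ (λ a b → ≃-reflexive (cong (kk (+ toℕ a))
        (trans (cong₂ (λ g z → g - + toℕ a + z) (above a) (dn≡pred (+ toℕ b))) (index (γ′ (suc (toℕ a))) (+ toℕ a) (+ toℕ b))))))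
      (≃-sym (gγ≃ γ′))))
    where
    open +-*-Solver
    index : ∀ g a b → (g + 1ℤ) - a + (ℤ.-1ℤ + b) ≡ g - a + b
    index = solve 3 (λ g a b → (g :+ con 1ℤ) :- a :+ (con ℤ.-1ℤ :+ b) := g :- a :+ b) refl

  raise-above : ∀ {γ γ′} i j n → OneAbove γ γ′ → OneAbove (raise γ i j n) (raise γ′ i j n)
  raise-above {γ} {γ′} i j n above a = trans (cong (λ g → g + _ - _) (above a))
    (solve 3 (λ g x y → (g :+ con 1ℤ) :+ x :- y := g :+ x :- y :+ con 1ℤ) refl (γ′ (suc (toℕ a))) (if suc (toℕ a) ≡ᵇ i then + n else 0ℤ) (if suc (toℕ a) ≡ᵇ j then + n else 0ℤ))
    where open +-*-Solver

  lower-above : ∀ {γ γ′} j → OneAbove γ γ′ → OneAbove (lower γ j) (lower γ′ j)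
  lower-above {γ} {γ′} j above a = trans (cong (_- _) (above a))
    (solve 2 (λ g x → (g :+ con 1ℤ) :- x := g :- x :+ con 1ℤ) refl (γ′ (suc (toℕ a))) (if suc (toℕ a) ≡ᵇ j then 1ℤ else 0ℤ))
    where open +-*-Solver

  E-expL : ∀ Ls {γ γ′} → OneAbove γ γ′ → E (+ ℓ) (expL ℓ Ls γ) ≃ expL ℓ Ls γ′
  E-expL [] {γ} {γ′} above = E-gγ {γ} {γ′} above
  E-expL ((i , j) ∷ Ls) {γ} {γ′} above = ≃-trans (P-- (E-additive (+ ℓ)) (expL ℓ Ls γ) (expL ℓ Ls (lower γ j)))
    (+-cong (E-expL Ls {γ} {γ′} above) (scale-cong (- 1ℤ) (E-expL Ls (lower-above {γ} {γ′} j above))))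

  E-expΨ : ∀ N Ψ Ls {γ γ′} → OneAbove γ γ′ → E (+ ℓ) (expΨ ℓ N Ψ Ls γ) ≃ expΨ ℓ N Ψ Ls γ′
  E-expΨ N [] Ls {γ} {γ′} above = E-expL Ls {γ} {γ′} above
  E-expΨ N ((i , j) ∷ Ψ) Ls {γ} {γ′} above = ≃-trans
    (sumΛ-additive (E-additive (+ ℓ)) (λ n → expΨ ℓ N Ψ Ls (raise γ i j n)) (upTo (suc N)))
    (sumΛ-cong (All.universal (λ n → E-expΨ N Ψ Ls (raise-above {γ} {γ′} i j n above)) (upTo (suc N))))

  Root : ℕ × ℕ → Set
  Root (i , j) = 1 ℕ.≤ i × i ℕ.< j × j ℕ.≤ ℓ

  -- Serves twice: with P = e_{ℓ+1+m}^⊥ and a trivial V, and with P the identity and V negative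
  -- weight.
  exp-vanish : ∀ {P} → Additive P → (V : (ℕ → ℤ) → Set) → (∀ γ → V γ → P (gγ ℓ γ) ≃ 0Λ) →
    (∀ γ j → V γ → V (lower γ j)) → (∀ γ i j n → Root (i , j) → V γ → V (raise γ i j n)) →
    ∀ N {Ψ} Ls {γ} → All Root Ψ → V γ → P (expΨ ℓ N Ψ Ls γ) ≃ 0Λ
  exp-vanish {P} p V van low rai N = goΨ
    where
    goL : ∀ Ls {γ} → V γ → P (expL ℓ Ls γ) ≃ 0Λ
    goL [] v = van _ v
    goL ((i , j) ∷ Ls) {γ} v = ≃-trans (P-- p (expL ℓ Ls γ) (expL ℓ Ls (lower γ j)))
      (+-cong (goL Ls v) (scale-cong (- 1ℤ) (goL Ls (low γ j v))))
    goΨ : ∀ {Ψ} Ls {γ} → All Root Ψ → V γ → P (expΨ ℓ N Ψ Ls γ) ≃ 0Λ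
    goΨ Ls [] v = goL Ls v
    goΨ {(i , j) ∷ Ψ} Ls {γ} (r ∷ rs) v = ≃-trans (sumΛ-additive p (λ n → expΨ ℓ N Ψ Ls (raise γ i j n)) (upTo (suc N)))
      (sumΛ-0 (All.universal (λ n → goΨ Ls rs (rai γ i j n r v)) (upTo (suc N))))

  E-expΨ-large : ∀ m N {Ψ} Ls γ → All Root Ψ → E (+ suc (ℓ ℕ.+ m)) (expΨ ℓ N Ψ Ls γ) ≃ 0Λ
  E-expΨ-large m N Ls γ rs = exp-vanish (E-additive (+ suc (ℓ ℕ.+ m))) (λ _ → ⊤) (λ γ _ → E-gγ-large m γ) (λ _ _ _ → tt) (λ _ _ _ _ _ _ → tt) N Ls rs tt

  -- Weights and independence of the truncation bound

  -- m times γ_m + ℓ - m, the largest index in row m of `gγ`. The absolute value of the sum over m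
  -- is `bound ℓ γ`.
  rowWeight : (ℕ → ℤ) → ℕ → ℤ
  rowWeight γ m = + m * γ m - + m * (+ m - + ℓ)

  weight : (ℕ → ℤ) → ℤ
  weight γ = sumℤ (map (rowWeight γ) (map suc (upTo ℓ)))

  sumℤ-neg : ∀ n (f : ℕ → ℤ) → sumℤ (applyUpTo f n) ℤ.< 0ℤ → Σ (Fin n) λ a → f (toℕ a) ℤ.< 0ℤ
  sumℤ-neg zero f (ℤ.+<+ ())
  sumℤ-neg (suc n) f neg with f 0 ℤ.<? 0ℤ
  ... | yes p = Fin.zero , p
  ... | no p with sumℤ-neg n (f ∘ suc) (ℤₚ.≤-<-trans (ℤₚ.≤-trans (ℤₚ.≤-reflexive (sym (ℤₚ.+-identityˡ _))) (ℤₚ.+-monoˡ-≤ (sumℤ (applyUpTo (f ∘ suc) n)) (ℤₚ.≮⇒≥ p))) neg)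
  ... | a , q = Fin.suc a , q

  sumℤ-≤ : ∀ n {f g : ℕ → ℤ} → (∀ m → f m ℤ.≤ g m) → sumℤ (applyUpTo f n) ℤ.≤ sumℤ (applyUpTo g n)
  sumℤ-≤ zero le = ℤₚ.≤-refl
  sumℤ-≤ (suc n) le = ℤₚ.+-mono-≤ (le 0) (sumℤ-≤ n (le ∘ suc))

  sumℤ-+ : ∀ n (f g : ℕ → ℤ) → sumℤ (applyUpTo (λ m → f m + g m) n) ≡ sumℤ (applyUpTo f n) + sumℤ (applyUpTo g n)
  sumℤ-+ zero f g = refl
  sumℤ-+ (suc n) f g = trans (cong (_+_ (f 0 + g 0)) (sumℤ-+ n (f ∘ suc) (g ∘ suc)))
    (solve 4 (λ a b c d → (a :+ b) :+ (c :+ d) := (a :+ c) :+ (b :+ d)) refl (f 0) (g 0) (sumℤ (applyUpTo (f ∘ suc) n)) (sumℤ (applyUpTo (g ∘ suc) n)))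
    where open +-*-Solver

  sumℤ-δ : ∀ n i → i ℕ.< n → (c : ℕ → ℤ) → sumℤ (applyUpTo (λ m → if m ≡ᵇ i then c m else 0ℤ) n) ≡ c i
  sumℤ-δ (suc n) zero _ c = trans (cong (_+_ (c 0)) (zeros n)) (ℤₚ.+-identityʳ (c 0))
    where
    zeros : ∀ n → sumℤ (applyUpTo (λ _ → 0ℤ) n) ≡ 0ℤ
    zeros zero = refl
    zeros (suc n) = trans (ℤₚ.+-identityˡ _) (zeros n)
  sumℤ-δ (suc n) (suc i) (ℕ.s≤s p) c = trans (ℤₚ.+-identityˡ _) (sumℤ-δ n i p (c ∘ suc))

  weight≡ : ∀ γ → weight γ ≡ sumℤ (applyUpTo (rowWeight γ ∘ suc) ℓ)
  weight≡ γ = cong sumℤ (trans (cong (map (rowWeight γ)) (map-upTo suc ℓ)) (map-applyUpTo suc (rowWeight γ) ℓ))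

  weight-lower : ∀ γ j → weight (lower γ j) ℤ.≤ weight γ
  weight-lower γ j = ≡.subst₂ ℤ._≤_ (sym (weight≡ (lower γ j))) (sym (weight≡ γ))
    (sumℤ-≤ ℓ λ m → ℤₚ.+-monoˡ-≤ (- (+ suc m * (+ suc m - + ℓ))) (ℤₚ.*-monoˡ-≤-nonNeg (+ suc m) (below (γ (suc m)) (suc m ≡ᵇ j))))
    where
    below : ∀ g t → g - (if t then 1ℤ else 0ℤ) ℤ.≤ g
    below g true = ℤₚ.i-j≤i g 1ℤ
    below g false = ℤₚ.≤-reflexive (ℤₚ.+-identityʳ g)

  -- The factor (z_i/z_j)^n changes the weight by (i - j) n, and i - j ≤ -1 for a root.
  weight-raise : ∀ γ i j n → Root (i , j) → weight (raise γ i j n) ℤ.≤ weight γ - + n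
  weight-raise γ (suc i) (suc j) n (_ , ℕ.s≤s i<j , j<ℓ) = begin
    weight (raise γ (suc i) (suc j) n)                ≡⟨ weight≡ (raise γ (suc i) (suc j) n) ⟩
    sumℤ (applyUpTo (rowWeight (raise γ (suc i) (suc j) n) ∘ suc) ℓ)
      ≡⟨ cong sumℤ (applyUpTo-cong ℓ (λ m → term m (m ≡ᵇ i) (m ≡ᵇ j))) ⟩
    sumℤ (applyUpTo (λ m → rowWeight γ (suc m) + ((if m ≡ᵇ i then + suc m * + n else 0ℤ) + (if m ≡ᵇ j then - (+ suc m * + n) else 0ℤ))) ℓ)
      ≡⟨ trans (sumℤ-+ ℓ _ _) (cong (_+_ (sumℤ (applyUpTo (rowWeight γ ∘ suc) ℓ))) (sumℤ-+ ℓ _ _)) ⟩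
    sumℤ (applyUpTo (rowWeight γ ∘ suc) ℓ) + (sumℤ (applyUpTo (λ m → if m ≡ᵇ i then + suc m * + n else 0ℤ) ℓ) + sumℤ (applyUpTo (λ m → if m ≡ᵇ j then - (+ suc m * + n) else 0ℤ) ℓ))
      ≡⟨ cong₂ _+_ (sym (weight≡ γ)) (cong₂ _+_ (sumℤ-δ ℓ i (ℕₚ.<-trans i<j j<ℓ) (λ m → + suc m * + n)) (sumℤ-δ ℓ j j<ℓ (λ m → - (+ suc m * + n)))) ⟩
    weight γ + (+ suc i * + n + - (+ suc j * + n))
      ≤⟨ ℤₚ.+-monoʳ-≤ (weight γ) (ℤₚ.+-monoʳ-≤ (+ suc i * + n) (ℤₚ.neg-mono-≤ (ℤₚ.*-monoʳ-≤-nonNeg (+ n) (ℤ.+≤+ (ℕ.s≤s i<j))))) ⟩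
    weight γ + (+ suc i * + n + - (+ suc (suc i) * + n))
      ≡⟨ cong (_+_ (weight γ)) (solve 2 (λ i n → i :* n :+ (:- ((con 1ℤ :+ i) :* n)) := :- n) refl (+ suc i) (+ n)) ⟩
    weight γ - + n ∎
    where
    open ℤₚ.≤-Reasoning
    open +-*-Solver
    applyUpTo-cong : ∀ n {f g : ℕ → ℤ} → (∀ m → f m ≡ g m) → applyUpTo f n ≡ applyUpTo g n
    applyUpTo-cong zero eq = refl
    applyUpTo-cong (suc n) eq = cong₂ _∷_ (eq 0) (applyUpTo-cong n (eq ∘ suc))
    term : ∀ m s t → + suc m * (γ (suc m) + (if s then + n else 0ℤ) - (if t then + n else 0ℤ)) - + suc m * (+ suc m - + ℓ) ≡
           rowWeight γ (suc m) + ((if s then + suc m * + n else 0ℤ) + (if t then - (+ suc m * + n) else 0ℤ))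
    term m true true = solve 4 (λ m g n z → m :* (g :+ n :- n) :- z := m :* g :- z :+ (m :* n :+ (:- (m :* n)))) refl (+ suc m) (γ (suc m)) (+ n) (+ suc m * (+ suc m - + ℓ))
    term m true false = solve 4 (λ m g n z → m :* (g :+ n :- con 0ℤ) :- z := m :* g :- z :+ (m :* n :+ con 0ℤ)) refl (+ suc m) (γ (suc m)) (+ n) (+ suc m * (+ suc m - + ℓ))
    term m false true = solve 4 (λ m g n z → m :* (g :+ con 0ℤ :- n) :- z := m :* g :- z :+ (con 0ℤ :+ (:- (m :* n)))) refl (+ suc m) (γ (suc m)) (+ n) (+ suc m * (+ suc m - + ℓ))
    term m false false = solve 3 (λ m g z → m :* (g :+ con 0ℤ :- con 0ℤ) :- z := m :* g :- z :+ (con 0ℤ :+ con 0ℤ)) refl (+ suc m) (γ (suc m)) (+ suc m * (+ suc m - + ℓ))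

  kk-neg : ∀ r {z} → z ℤ.< 0ℤ → kk r z ≡ 0Λ
  kk-neg r {+ n} (ℤ.+<+ ())
  kk-neg r { -[1+ n ]} _ = refl

  gγ-vanish : ∀ γ → weight γ ℤ.< 0ℤ → gγ ℓ γ ≃ 0Λ
  gγ-vanish γ neg with sumℤ-neg ℓ (rowWeight γ ∘ suc) (subst (ℤ._< 0ℤ) (weight≡ γ) neg)
  ... | a , p = ≃-trans (gγ≃ γ) (Λ-Det.det-zero-row ℓ _ a (λ b → ≃-reflexive (kk-neg (+ toℕ a) (index b))))
    where
    g = γ (suc (toℕ a))
    small : g ℤ.< + suc (toℕ a) - + ℓ
    -- The row weight is negative, so its nonnegative factor `suc (toℕ a)` can be cancelled.
    small = ℤₚ.*-cancelˡ-<-nonNeg (+ suc (toℕ a)) (ℤₚ.≰⇒> λ le → ℤₚ.<⇒≱ p (ℤₚ.i≤j⇒0≤j-i le))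
    index : ∀ b → g - + toℕ a + + toℕ b ℤ.< 0ℤ
    index b = begin-strict
      g - + toℕ a + + toℕ b                              <⟨ ℤₚ.+-monoˡ-< (+ toℕ b) (ℤₚ.+-monoˡ-< (- + toℕ a) small) ⟩
      + suc (toℕ a) - + ℓ - + toℕ a + + toℕ b            ≡⟨ solve 3 (λ a l b → con 1ℤ :+ a :- l :- a :+ b := (con 1ℤ :+ b) :- l) refl (+ toℕ a) (+ ℓ) (+ toℕ b) ⟩
      + suc (toℕ b) - + ℓ                                ≤⟨ ℤₚ.i≤j⇒i-j≤0 (ℤ.+≤+ (Finₚ.toℕ<n b)) ⟩
      0ℤ ∎
      where
      open ℤₚ.≤-Reasoning
      open +-*-Solver

  expΨ-vanish : ∀ N {Ψ} Ls {γ} → All Root Ψ → weight γ ℤ.< 0ℤ → expΨ ℓ N Ψ Ls γ ≃ 0Λ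
  expΨ-vanish = exp-vanish id-additive (λ γ → weight γ ℤ.< 0ℤ) gγ-vanish
    (λ γ j neg → ℤₚ.≤-<-trans (weight-lower γ j) neg)
    (λ γ i j n r neg → ℤₚ.≤-<-trans (weight-raise γ i j n r) (ℤₚ.≤-<-trans (ℤₚ.i-j≤i (weight γ) (+ n)) neg))

  sumΛ-++ : ∀ (f : ℕ → Λ) n m → sumΛ (applyUpTo f (n ℕ.+ m)) ≃ sumΛ (applyUpTo f n) +Λ sumΛ (applyUpTo (λ i → f (n ℕ.+ i)) m)
  sumΛ-++ f zero m = ≃-refl
  sumΛ-++ f (suc n) m = ≃-trans (ΛR.+-congˡ (sumΛ-++ (f ∘ suc) n m)) (≃-sym (ΛR.+-assoc (f 0) (sumΛ (applyUpTo (f ∘ suc) n)) _))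

  -- An exponent n > N makes the weight negative, so these terms vanish. For n ≤ N the weight does
  -- not grow, and the bound N stays valid for the remaining roots.
  expΨ-truncate : ∀ N M {Ψ} Ls {γ} → All Root Ψ → weight γ ℤ.≤ + N → expΨ ℓ (N ℕ.+ M) Ψ Ls γ ≃ expΨ ℓ N Ψ Ls γ
  expΨ-truncate N M Ls [] le = ≃-refl
  expΨ-truncate N M {(i , j) ∷ Ψ} Ls {γ} (r ∷ rs) le = begin
    sumΛ (map f (upTo (suc N ℕ.+ M)))                                       ≡⟨ cong sumΛ (map-upTo f (suc N ℕ.+ M)) ⟩
    sumΛ (applyUpTo f (suc N ℕ.+ M))                                        ≈⟨ sumΛ-++ f (suc N) M ⟩
    sumΛ (applyUpTo f (suc N)) +Λ sumΛ (applyUpTo (λ n → f (suc N ℕ.+ n)) M) ≡⟨ cong₂ (λ x y → sumΛ x +Λ sumΛ y) (sym (map-upTo f (suc N))) (sym (map-upTo (λ n → f (suc N ℕ.+ n)) M)) ⟩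
    sumΛ (map f (upTo (suc N))) +Λ sumΛ (map (λ n → f (suc N ℕ.+ n)) (upTo M))
      ≈⟨ +-cong (sumΛ-cong (All.universal (λ n → expΨ-truncate N M Ls rs (ℤₚ.≤-trans (weight-raise γ i j n r) (ℤₚ.≤-trans (ℤₚ.i-j≤i (weight γ) (+ n)) le))) (upTo (suc N))))
           (sumΛ-0 (All.universal (λ n → expΨ-vanish (N ℕ.+ M) Ls rs (ℤₚ.≤-<-trans (weight-raise γ i j (suc N ℕ.+ n) r) (beyond n))) (upTo M))) ⟩
    expΨ ℓ N ((i , j) ∷ Ψ) Ls γ +Λ 0Λ                                       ≈⟨ ΛR.+-identityʳ (expΨ ℓ N ((i , j) ∷ Ψ) Ls γ) ⟩
    expΨ ℓ N ((i , j) ∷ Ψ) Ls γ ∎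
    where
    open import Relation.Binary.Reasoning.Setoid ΛR.setoid
    f : ℕ → Λ
    f n = expΨ ℓ (N ℕ.+ M) Ψ Ls (raise γ i j n)
    beyond : ∀ n → weight γ - + (suc N ℕ.+ n) ℤ.< 0ℤ
    beyond n = subst (weight γ - + (suc N ℕ.+ n) ℤ.<_) (ℤₚ.+-inverseʳ (+ (suc N ℕ.+ n)))
      (ℤₚ.+-monoˡ-< (- + (suc N ℕ.+ n)) (ℤₚ.≤-<-trans le (ℤ.+<+ (ℕ.s≤s (ℕₚ.m≤m+n N n)))))

  expΨ-bound : ∀ N M {Ψ} Ls {γ} → All Root Ψ → weight γ ℤ.≤ + N → weight γ ℤ.≤ + M → expΨ ℓ N Ψ Ls γ ≃ expΨ ℓ M Ψ Ls γ
  expΨ-bound N M {Ψ} Ls {γ} rs p q = ≃-trans (≃-sym (expΨ-truncate N M Ls rs p))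
    (≃-trans (≃-reflexive (cong (λ K → expΨ ℓ K Ψ Ls γ) (ℕₚ.+-comm N M))) (expΨ-truncate M N Ls rs q))

  Δ⁺-roots : All Root (Δ⁺ ℓ)
  Δ⁺-roots = All.zipWith (λ { {i , j} (lt , (p , q)) → proj₁ p , ℕₚ.<ᵇ⇒< i j lt , proj₂ q })
    ( Allₚ.all-filter (T? ∘ λ p → proj₁ p ℕ.<ᵇ proj₂ p) pairs
    , Allₚ.filter⁺ (T? ∘ λ p → proj₁ p ℕ.<ᵇ proj₂ p) (Allₚ.cartesianProduct⁺ (≡.setoid ℕ) (≡.setoid ℕ) range range
        (λ x∈ y∈ → All.lookup bounds x∈ , All.lookup bounds y∈)))
    where
    range = map suc (upTo ℓ)
    pairs = cartesianProduct range range
    bounds : All (λ i → 1 ℕ.≤ i × i ℕ.≤ ℓ) range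
    bounds = Allₚ.map⁺ (All.map (λ lt → ℕ.s≤s ℕ.z≤n , lt) (Allₚ.all-upTo ℓ))

-- Comparison of λ with λ+1^ℓ and the conclusion

filterᵇ-cong : ∀ {A : Set} (p q : A → Bool) {xs} → All (λ x → p x ≡ q x) xs → filterᵇ p xs ≡ filterᵇ q xs
filterᵇ-cong p q [] = refl
filterᵇ-cong p q {x ∷ xs} (eq ∷ eqs) with p x | q x | eq
... | true  | true  | _ = cong (x ∷_) (filterᵇ-cong p q eqs)
... | false | false | _ = filterᵇ-cong p q eqs

at-plus1 : ∀ {ℓ} (la : Vec ℕ ℓ) (a : Fin ℓ) → at (plus1 la) (suc (toℕ a)) ≡ at la (suc (toℕ a)) + 1ℤ
at-plus1 (x ∷ la) Fin.zero = cong +_ (ℕₚ.+-comm 1 x)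
at-plus1 (x ∷ la) (Fin.suc a) = at-plus1 la a

-- The level and λ_i grow together, so the defining inequality is unchanged. Being a root places i
-- in 1,...,ℓ, where `at (plus1 la)` does exceed `at la` by one.
Δᵐ-plus1 : ∀ {ℓ} k (la : Vec ℕ ℓ) {p} → Root ℓ p → Δᵐ (suc k) (plus1 la) (proj₁ p) (proj₂ p) ≡ Δᵐ k la (proj₁ p) (proj₂ p)
Δᵐ-plus1 {ℓ} k la {suc i , j} (_ , lt , le) = cong (λ z → does (z ℤ.<? + j)) (begin
  + suc k - at (plus1 la) (suc i) + + suc i      ≡⟨ cong (λ g → + suc k - g + + suc i) at-i ⟩
  + suc k - (at la (suc i) + 1ℤ) + + suc i       ≡⟨ solve 3 (λ k g i → con 1ℤ :+ k :- (g :+ con 1ℤ) :+ i := k :- g :+ i) refl (+ k) (at la (suc i)) (+ suc i) ⟩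
  + k - at la (suc i) + + suc i ∎)
  where
  open ≡-Reasoning
  open +-*-Solver
  i<ℓ : i ℕ.< ℓ
  i<ℓ = ℕₚ.≤-trans (ℕₚ.<⇒≤ lt) le
  at-i : at (plus1 la) (suc i) ≡ at la (suc i) + 1ℤ
  at-i = subst (λ n → at (plus1 la) (suc n) ≡ at la (suc n) + 1ℤ) (Finₚ.toℕ-fromℕ< i<ℓ) (at-plus1 la (Fin.fromℕ< i<ℓ))

i≤∣i∣ : ∀ i → i ℤ.≤ + ∣ i ∣
i≤∣i∣ (+ n) = ℤₚ.≤-refl
i≤∣i∣ -[1+ n ] = ℤ.-≤+

module _ {ℓ : ℕ} (k : ℕ) (la : Vec ℕ ℓ) where

  Ψ Ls : List (ℕ × ℕ)
  Ψ = filterᵇ (λ p → Δᵐ k la (proj₁ p) (proj₂ p)) (Δ⁺ ℓ)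
  Ls = filterᵇ (λ p → Δᵐ (suc k) la (proj₁ p) (proj₂ p)) (Δ⁺ ℓ)

  Ψ-roots : All (Root ℓ) Ψ
  Ψ-roots = Allₚ.filter⁺ (T? ∘ λ p → Δᵐ k la (proj₁ p) (proj₂ p)) (Δ⁺-roots ℓ)

  N⁺ : ℕ
  N⁺ = bound ℓ (at (plus1 la))

  𝔤-plus1 : 𝔤 (suc k) (plus1 la) ≡ expΨ ℓ N⁺ Ψ Ls (at (plus1 la))
  𝔤-plus1 = cong₂ (λ Ψ Ls → expΨ ℓ N⁺ Ψ Ls (at (plus1 la)))
    (filterᵇ-cong _ _ (All.map (Δᵐ-plus1 k la) (Δ⁺-roots ℓ)))
    (filterᵇ-cong _ _ (All.map (Δᵐ-plus1 (suc k) la) (Δ⁺-roots ℓ)))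

  -- After e_ℓ^⊥ the expansion for λ is still truncated at the bound of λ+1^ℓ; this shows that bound
  -- to be large enough for λ.
  weight-plus1 : weight ℓ (at la) ℤ.≤ weight ℓ (at (plus1 la))
  weight-plus1 = ≡.subst₂ ℤ._≤_ (sym (weight≡ ℓ (at la))) (sym (weight≡ ℓ (at (plus1 la))))
    (sumℤ-≤ ℓ ℓ λ m → ℤₚ.+-monoˡ-≤ (- (+ suc m * (+ suc m - + ℓ))) (ℤₚ.*-monoˡ-≤-nonNeg (+ suc m) (at-≤ la m)))
    where
    at-≤ : ∀ {ℓ} (la : Vec ℕ ℓ) m → at la (suc m) ℤ.≤ at (plus1 la) (suc m)
    at-≤ [] m = ℤₚ.≤-refl
    at-≤ (x ∷ la) zero = ℤ.+≤+ (ℕₚ.n≤1+n x)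
    at-≤ (x ∷ la) (suc m) = at-≤ la m

  E-𝔤 : E (+ ℓ) (𝔤 (suc k) (plus1 la)) ≃ 𝔤 k la
  E-𝔤 = ≃-trans (≃-reflexive (cong (E (+ ℓ)) 𝔤-plus1)) (≃-trans
    (E-expΨ ℓ N⁺ Ψ Ls {at (plus1 la)} {at la} (at-plus1 la))
    (expΨ-bound ℓ N⁺ (bound ℓ (at la)) Ls Ψ-roots (ℤₚ.≤-trans weight-plus1 (i≤∣i∣ (weight ℓ (at (plus1 la))))) (i≤∣i∣ (weight ℓ (at la)))))

  E-𝔤-large : ∀ m → E (+ suc (ℓ ℕ.+ m)) (𝔤 (suc k) (plus1 la)) ≃ 0Λ
  E-𝔤-large m = ≃-trans (≃-reflexive (cong (E (+ suc (ℓ ℕ.+ m))) 𝔤-plus1)) (E-expΨ-large ℓ m N⁺ Ls (at (plus1 la)) Ψ-roots)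

nC0≡1 : ∀ n → n C 0 ≡ 1
nC0≡1 n = trans (nCk≡nC[n∸k] {n = n} ℕ.z≤n) (nCn≡1 n)

Gcoef-0 : ∀ ℓ → Gcoef ℓ 0 ≡ 1ℤ
Gcoef-0 ℓ = trans (ℤₚ.*-identityˡ _) (binom-0 (+ ℓ - 1ℤ + 0ℤ))
  where
  binom-0 : ∀ z → binomℤ z 0 ≡ 1ℤ
  binom-0 (+ n) = cong +_ (nC0≡1 n)
  -- Occurs for ℓ = 0, where the upper entry of the binomial is -1.
  binom-0 -[1+ m ] = trans (ℤₚ.*-identityˡ _) (cong +_ (nC0≡1 (m ℕ.+ 0)))

sumℤ-zero : ∀ {A : Set} {f : A → ℤ} {xs} → All (λ x → f x ≡ 0ℤ) xs → sumℤ (map f xs) ≡ 0ℤ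
sumℤ-zero [] = refl
sumℤ-zero (eq ∷ eqs) = cong₂ _+_ eq (sumℤ-zero eqs)

theorem2p7 : (k ℓ : ℕ) → 1 ≤ k → (la : Vec ℕ ℓ) → Par k la →
    (B : Λ → Λ → ℤ) → IsHall B → (x : Λ) →
    GperpPair ℓ B (𝔤 (suc k) (plus1 la)) x ≡ B (𝔤 k la) x
theorem2p7 k ℓ _ la _ B hall x = begin
  -- The range 0 ≤ i ≤ `wdeg X` always contains i = 0; all later terms vanish by `higher`.
  Gcoef ℓ 0 * B X (e (ℓ ℕ.+ 0) *Λ x) + sumℤ (map term (applyUpTo suc (wdeg X)))
    ≡⟨ cong₂ _+_ (cong₂ _*_ (Gcoef-0 ℓ) (cong (λ n → B X (e n *Λ x)) (ℕₚ.+-identityʳ ℓ)))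
         (sumℤ-zero (Allₚ.applyUpTo⁺₂ suc (wdeg X) higher)) ⟩
  1ℤ * B X (e ℓ *Λ x) + 0ℤ     ≡⟨ trans (ℤₚ.+-identityʳ _) (ℤₚ.*-identityˡ _) ⟩
  B X (e ℓ *Λ x)               ≡⟨ e⊥-adjoint hall ℓ X x ⟩
  B (E (+ ℓ) X) x              ≡⟨ ⟪⟫-resp (E-𝔤 k la) ≃-refl ⟩
  B (𝔤 k la) x ∎
  where
  open ≡-Reasoning
  open Λ-Pieri.IsHallForm (isHallForm hall) using (⟪⟫-resp)
  open Λ-Pieri.Hall (isHallForm hall) using (⟪⟫-0ˡ)
  X = 𝔤 (suc k) (plus1 la)
  term : ℕ → ℤ
  term i = Gcoef ℓ i * B X (e (ℓ ℕ.+ i) *Λ x)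
  higher : ∀ i → term (suc i) ≡ 0ℤ
  higher i = begin
    Gcoef ℓ (suc i) * B X (e (ℓ ℕ.+ suc i) *Λ x)   ≡⟨ cong (λ n → Gcoef ℓ (suc i) * B X (e n *Λ x)) (ℕₚ.+-suc ℓ i) ⟩
    Gcoef ℓ (suc i) * B X (e (suc (ℓ ℕ.+ i)) *Λ x) ≡⟨ cong (Gcoef ℓ (suc i) *_) (trans (e⊥-adjoint hall (suc (ℓ ℕ.+ i)) X x)
                                                        (trans (⟪⟫-resp (E-𝔤-large k la i) ≃-refl) (⟪⟫-0ˡ x))) ⟩
    Gcoef ℓ (suc i) * 0ℤ                           ≡⟨ ℤₚ.*-zeroʳ (Gcoef ℓ (suc i)) ⟩
    0ℤ ∎
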